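{- Let $(S,\rho)$ be a strict Robinson space with $S=\{1,2,\dots,n\}$, $n\ge 2$, for which the identity order $1<2<\cdots<n$ is compatible. Then $(S,\rho)$ admits a valid drawing in a caterpillar if and only if the following system is infeasible, i.e. there is no vector $\mathbf{y_N}\in\mathbb{R}^{(n-1)(n-2)}$ with $$\mathbf{Y_S}\,\mathbf{y_N}\ge 0,\qquad \mathbf{y_N}\ge 0,\qquad \mathbf{y_N}\ne 0,$$ where inequalities between vectors are componentwise.
   Context: A dissimilarity on a finite set $S$ is a function $\rho:S\times S\to\mathbb{R}_{\ge 0}$ with $\rho(x,y)=\rho(y,x)$ for all $x,y$, and $\rho(x,y)=0$ if and only if $x=y$; $(S,\rho)$ is then a dissimilarity space. It is Robinson if there is a total order $<$ on $S$ (a compatible order) such that $\rho(x,z)\ge\max\{\rho(x,y),\rho(y,z)\}$ for all $x<y<z$. It is strict if $\rho(x,y)\ne\rho(u,v)$ for any two distinct unordered pairs $\{x,y\}\ne\{u,v\}$ that are not both on the diagonal (i.e. $x\ne y$ or $u\neq v$). Centers: for $i<k$, $L(i,k)=\max\{j\in[i,k]:\rho(i,j)<\rho(j,k)\}$ and $R(k,i)=\min\{j\in[i,k]:\rho(i,j)>\rho(j,k)\}$, where $[i,k]=\{i,i+1,\dots,k\}$. Matrix $\mathbf{Y_S}$: consider real variables $h_2,\dots,h_n,l_2,\dots,l_n$ and put $h_1=l_1=0$. Let $\mathbf{A_S}$ be the $n(n-1)\times(2n-2)$ matrix whose columns are indexed by these variables and whose rows are indexed by the ordered pairs of distinct elements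 of $\{1,\dots,n\}$; for $i<j$, row $(i,j)$ is the coefficient vector of the linear form $h_i+h_j-2h_{L(i,j)}-l_i+l_j$, and row $(j,i)$ is the coefficient vector of the linear form $-h_i-h_j+2h_{R(j,i)}+l_i-l_j$. Let $\mathbf{B_S}$ be the square submatrix formed by the rows indexed by consecutive pairs, in the order $(1,2),\dots,(n-1,n),(2,1),\dots,(n,n-1)$, and $\mathbf{N_S}$ the submatrix formed by the remaining $(n-1)(n-2)$ rows, indexed by pairs with $|i-j|>1$. The matrix $\mathbf{B_S}$ is invertible, and $\mathbf{Y_S}:=-(\mathbf{B_S}^\top)^{ -1}\mathbf{N_S}^\top$. A valid drawing of $(S,\rho)$ in a metric space $(\mathcal{X},d)$ is an injection $I:S\to\mathcal{X}$ such that for all $x,y,z\in S$ with $\rho(x,y)<\rho(x,z)$ one has $d(I(x),I(y))<d(I(x),I(z))$. A caterpillar graph is a finite tree such that deleting all its leaves leaves a path (possibly empty or a single vertex). A caterpillar is a caterpillar graph with positive edge lengths, viewed as a metric space on its vertex set with the weighted path metric. -}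

module Defs where

open import Algebra.Bundles using (CommutativeRing)
open import Algebra.Solver.Ring.AlmostCommutativeRing
  using (fromCommutativeRing; _-Raw-AlmostCommutative⟶_)
open import Data.Bool.Base using (if_then_else_)
open import Data.Empty using (⊥-elim)
open import Data.Fin.Base as Fin
  using (Fin; zero; suc; toℕ; inject₁; fromℕ; splitAt; _↑ˡ_; _↑ʳ_)
import Data.Fin.Properties as Finₚ
open import Data.List.Base as List
  using (List; length; filter; cartesianProduct; allFin)
open import Data.Integer.Base as ℤ using (ℤ; +_; -[1+_]; _⊖_)
import Data.Integer.Properties as ℤₚ
import Data.List.Extrema as Extrema
open import Data.List.Membership.Propositional using (_∈_)
open import Data.List.Membership.Propositional.Properties using (∈-filter⁻)
open import Data.Maybe.Base using (Maybe; map)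
open import Data.Nat.Base as ℕ using (ℕ; zero; suc; ∣_-_∣)
import Data.Nat.Properties as ℕₚ
open import Data.Product using (Σ; ∃; ∃!; _×_; _,_; proj₁; proj₂)
open import Data.Sum.Base using (_⊎_; inj₁; inj₂)
open import Data.Vec.Functional using (Vector; _++_)
open import Function.Base using (_∘_)
open import Function.Bundles using (_⇔_)
open import Function.Definitions using (Injective)
open import Level using (0ℓ)
open import Relation.Binary.Construct.Closure.ReflexiveTransitive
  using (Star; ε; _◅_)
open import Relation.Binary.Core using (Rel)
open import Relation.Binary.Definitions
  using (Decidable; Irreflexive; Symmetric; tri<; tri≈; tri>)
open import Relation.Binary.PropositionalEquality as ≡ using (_≡_; _≢_)
open import Relation.Binary.Structures using (IsStrictTotalOrder)
open import Relation.Nullary.Decidable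
  using (Dec; does; _×-dec_; dec⇒maybe)
open import Relation.Nullary.Negation using (¬_)
open import Relation.Unary using (Pred)

-- The library has no real numbers.  They are taken axiomatically, as a
-- Dedekind-complete totally ordered field, which determines them up to
-- isomorphism; as in classical analysis the order is trichotomous.
record RealNumbers : Set₁ where
  field
    commutativeRing : CommutativeRing 0ℓ 0ℓ

  open CommutativeRing commutativeRing public

  infix 4 _<_ _≤_

  field
    _<_                : Rel Carrier 0ℓ
    isStrictTotalOrder : IsStrictTotalOrder _≈_ _<_
    +-monoʳ-<          : ∀ x {y z} → y < z → x + y < x + z
    *-pos              : ∀ {x y} → 0# < x → 0# < y → 0# < x * y
    0<1                : 0# < 1#
    inverse            : ∀ x → ¬ x ≈ 0# → ∃ λ y → x * y ≈ 1#

  _≤_ : Rel Carrier 0ℓ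
  x ≤ y = x < y ⊎ x ≈ y

  IsUpperBound : Pred Carrier 0ℓ → Carrier → Set
  IsUpperBound P b = ∀ x → P x → x ≤ b

  field
    supremum : (P : Pred Carrier 0ℓ) → ∃ P → ∃ (IsUpperBound P) →
               ∃ λ s → IsUpperBound P s × (∀ b → IsUpperBound P b → s ≤ b)

  open IsStrictTotalOrder isStrictTotalOrder public
    using (compare; _<?_; _≟_; irrefl; <-respˡ-≈; <-respʳ-≈)
    renaming (trans to <-trans; asym to <-asym)

record Graph : Set₁ where
  field
    order      : ℕ
    Adj        : Rel (Fin order) 0ℓ
    adj?       : Decidable Adj
    adj-sym    : Symmetric Adj
    adj-irrefl : Irreflexive _≡_ Adj

  V : Set
  V = Fin order

  Connected : Set
  Connected = ∀ u v → Star Adj u v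

  -- A cycle on the k + 1 ≥ 3 distinct vertices c 0, …, c k.
  IsCycle : ∀ {k} → (Fin (suc k) → V) → Set
  IsCycle {k} c = (2 ℕ.≤ k) × Injective _≡_ _≡_ c ×
                  (∀ i → Adj (c (inject₁ i)) (c (suc i))) ×
                  Adj (c (fromℕ k)) (c zero)

  -- The first component says that there is at least one vertex.
  IsTree : Set
  IsTree = V × Connected × (∀ {k} (c : Fin (suc k) → V) → ¬ IsCycle c)

  IsLeaf : V → Set
  IsLeaf v = ∃! _≡_ (Adj v)

  Consecutive : ∀ {k} → Rel (Fin k) 0ℓ
  Consecutive i j = (toℕ j ≡ suc (toℕ i)) ⊎ (toℕ i ≡ suc (toℕ j))

  -- The subgraph induced on the vertices satisfying P is a path with k
  -- vertices; k = 0 and k = 1 are allowed.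
  InducesPath : Pred V 0ℓ → Set
  InducesPath P = ∃ λ k → Σ (Fin k → V) λ s →
    Injective _≡_ _≡_ s ×
    (∀ v → P v ⇔ (∃ λ i → s i ≡ v)) ×
    (∀ i j → Adj (s i) (s j) ⇔ Consecutive i j)

  IsCaterpillarGraph : Set
  IsCaterpillarGraph = IsTree × InducesPath (λ v → ¬ IsLeaf v)

-- The ring solver, with integer coefficients: in an abstract ring,
-- coefficients taken from the ring itself do not compute.
module IntegerCoefficients {c ℓ} (R : CommutativeRing c ℓ) where

  open CommutativeRing R hiding (zero)
  open import Algebra.Properties.Ring ring
  open import Algebra.Properties.Semiring.Mult.TCOptimised semiring
    using (×-homo-+; ×1-homo-*) renaming (_×_ to _·_)
  open import Relation.Binary.Reasoning.Setoid setoid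

  ⟦_⟧ : ℤ → Carrier
  ⟦ + n      ⟧ = n · 1#
  ⟦ -[1+ n ] ⟧ = - (suc n · 1#)

  neg-homo : ∀ i → ⟦ ℤ.- i ⟧ ≈ - ⟦ i ⟧
  neg-homo (+ zero)   = sym -0#≈0#
  neg-homo (+ suc n)  = refl
  neg-homo (-[1+ n ]) = sym (-‿involutive _)

  ⊖-homo : ∀ m n → ⟦ m ⊖ n ⟧ ≈ m · 1# - n · 1#
  ⊖-homo m       zero    = sym (trans (+-congˡ -0#≈0#) (+-identityʳ _))
  ⊖-homo zero    (suc n) = sym (+-identityˡ _)
  ⊖-homo (suc m) (suc n) = begin
    ⟦ suc m ⊖ suc n ⟧                ≡⟨ ≡.cong ⟦_⟧ (ℤₚ.[1+m]⊖[1+n]≡m⊖n m n) ⟩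
    ⟦ m ⊖ n ⟧                        ≈⟨ ⊖-homo m n ⟩
    m · 1# - n · 1#                  ≈⟨ +-congʳ (+-identityʳ _) ⟨
    (m · 1# + 0#) - n · 1#           ≈⟨ +-congʳ (+-congˡ (-‿inverseʳ 1#)) ⟨
    (m · 1# + (1# - 1#)) - n · 1#    ≈⟨ +-congʳ (+-assoc _ _ _) ⟨
    ((m · 1# + 1#) - 1#) - n · 1#    ≈⟨ +-assoc _ _ _ ⟩
    (m · 1# + 1#) + (- 1# - n · 1#)  ≈⟨ +-cong (trans (+-comm _ _) (sym (×-homo-+ 1# 1 m)))
                                          (trans (-‿+-comm _ _) (-‿cong (sym (×-homo-+ 1# 1 n)))) ⟩
    suc m · 1# - suc n · 1#          ∎

  +-homo : ∀ i j → ⟦ i ℤ.+ j ⟧ ≈ ⟦ i ⟧ + ⟦ j ⟧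
  +-homo (+ m)      (+ n)      = ×-homo-+ 1# m n
  +-homo (+ m)      (-[1+ n ]) = ⊖-homo m (suc n)
  +-homo (-[1+ m ]) (+ n)      = trans (⊖-homo n (suc m)) (+-comm _ _)
  +-homo (-[1+ m ]) (-[1+ n ]) = begin
    - (suc (suc (m ℕ.+ n)) · 1#)      ≡⟨ ≡.cong (λ k → - (suc k · 1#)) (ℕₚ.+-suc m n) ⟨
    - ((suc m ℕ.+ suc n) · 1#)        ≈⟨ -‿cong (×-homo-+ 1# (suc m) (suc n)) ⟩
    - (suc m · 1# + suc n · 1#)       ≈⟨ -‿+-comm _ _ ⟨
    - (suc m · 1#) + - (suc n · 1#)   ∎

  *-homo⁺ : ∀ m j → ⟦ + m ℤ.* j ⟧ ≈ m · 1# * ⟦ j ⟧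
  *-homo⁺ m (+ n)      = trans (reflexive (≡.cong ⟦_⟧ (≡.sym (ℤₚ.pos-* m n))))
                               (×1-homo-* m n)
  *-homo⁺ m (-[1+ n ]) = begin
    ⟦ + m ℤ.* -[1+ n ] ⟧         ≡⟨ ≡.cong ⟦_⟧ (ℤₚ.neg-distribʳ-* (+ m) (+ suc n)) ⟨
    ⟦ ℤ.- (+ m ℤ.* + suc n) ⟧    ≈⟨ neg-homo (+ m ℤ.* + suc n) ⟩
    - ⟦ + m ℤ.* + suc n ⟧        ≈⟨ -‿cong (*-homo⁺ m (+ suc n)) ⟩
    - (m · 1# * (suc n · 1#))    ≈⟨ -‿distribʳ-* _ _ ⟩
    m · 1# * - (suc n · 1#)      ∎

  *-homo : ∀ i j → ⟦ i ℤ.* j ⟧ ≈ ⟦ i ⟧ * ⟦ j ⟧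
  *-homo (+ m)      j = *-homo⁺ m j
  *-homo (-[1+ m ]) j = begin
    ⟦ -[1+ m ] ℤ.* j ⟧        ≡⟨ ≡.cong ⟦_⟧ (ℤₚ.neg-distribˡ-* (+ suc m) j) ⟨
    ⟦ ℤ.- (+ suc m ℤ.* j) ⟧   ≈⟨ neg-homo (+ suc m ℤ.* j) ⟩
    - ⟦ + suc m ℤ.* j ⟧       ≈⟨ -‿cong (*-homo⁺ (suc m) j) ⟩
    - (suc m · 1# * ⟦ j ⟧)    ≈⟨ -‿distribˡ-* _ _ ⟩
    - (suc m · 1#) * ⟦ j ⟧    ∎

  homomorphism : ℤ.+-*-rawRing -Raw-AlmostCommutative⟶ fromCommutativeRing R
  homomorphism = record
    { ⟦_⟧    = ⟦_⟧
    ; +-homo = +-homo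
    ; *-homo = *-homo
    ; -‿homo = neg-homo
    ; 0-homo = refl
    ; 1-homo = refl
    }

  ⟦⟧-≟ : ∀ i j → Maybe (⟦ i ⟧ ≈ ⟦ j ⟧)
  ⟦⟧-≟ i j = map (λ i≡j → reflexive (≡.cong ⟦_⟧ i≡j)) (dec⇒maybe (i ℤₚ.≟ j))

  open import Algebra.Solver.Ring
    ℤ.+-*-rawRing (fromCommutativeRing R) homomorphism ⟦⟧-≟
    public using (solve; _:=_; _:+_; _:*_; _:-_; :-_; con)

module Definitions (ℝ : RealNumbers) where

  open RealNumbers ℝ hiding (zero)

  module _ {S : Set} where

    record IsDissimilarity (ρ : S → S → Carrier) : Set where
      field
        nonneg : ∀ x y → 0# ≤ ρ x y
        ρ-sym  : ∀ x y → ρ x y ≈ ρ y x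
        ρ≈0⇒≡  : ∀ {x y} → ρ x y ≈ 0# → x ≡ y
        ρ-diag : ∀ x → ρ x x ≈ 0#

    Compatible : Rel S 0ℓ → (S → S → Carrier) → Set
    Compatible _≺_ ρ = ∀ {x y z} → x ≺ y → y ≺ z →
                       (ρ x y ≤ ρ x z) × (ρ y z ≤ ρ x z)

    IsRobinson : (S → S → Carrier) → Set₁
    IsRobinson ρ = Σ (Rel S 0ℓ) λ _≺_ →
                   IsStrictTotalOrder _≡_ _≺_ × Compatible _≺_ ρ

    SameUnorderedPair : S → S → S → S → Set
    SameUnorderedPair x y u v = (x ≡ u × y ≡ v) ⊎ (x ≡ v × y ≡ u)

    IsStrict : (S → S → Carrier) → Set
    IsStrict ρ = ∀ x y u v → ¬ SameUnorderedPair x y u v →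
                 (x ≢ y) ⊎ (u ≢ v) → ¬ ρ x y ≈ ρ u v

    record IsStrictRobinson (ρ : S → S → Carrier) : Set₁ where
      field
        isDissimilarity : IsDissimilarity ρ
        isRobinson      : IsRobinson ρ
        isStrict        : IsStrict ρ

    IsValidDrawing : {X : Set} → (S → S → Carrier) → (X → X → Carrier) →
                     (S → X) → Set
    IsValidDrawing ρ d I =
      Injective _≡_ _≡_ I ×
      (∀ x y z → ρ x y < ρ x z → d (I x) (I y) < d (I x) (I z))

  record WeightedGraph : Set₁ where
    field
      graph          : Graph
    open Graph graph public
    field
      -- Only the values on edges are meaningful.
      edgeLength     : V → V → Carrier
      edgeLength-sym : ∀ {u v} → Adj u v → edgeLength u v ≈ edgeLength v u
      edgeLength-pos : ∀ {u v} → Adj u v → 0# < edgeLength u v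

    walkLength : ∀ {u v} → Star Adj u v → Carrier
    walkLength ε                 = 0#
    walkLength (_◅_ {u} {v} _ w) = edgeLength u v + walkLength w

    -- In a tree the minimal walk is the unique path.
    IsPathMetric : (V → V → Carrier) → Set
    IsPathMetric dist =
      (∀ u v → Σ (Star Adj u v) λ w → dist u v ≈ walkLength w) ×
      (∀ {u v} (w : Star Adj u v) → dist u v ≤ walkLength w)

  record Caterpillar : Set₁ where
    field
      weightedGraph      : WeightedGraph
    open WeightedGraph weightedGraph public
    field
      isCaterpillarGraph : IsCaterpillarGraph
      dist               : V → V → Carrier
      isPathMetric       : IsPathMetric dist

  AdmitsCaterpillarDrawing : {S : Set} → (S → S → Carrier) → Set₁
  AdmitsCaterpillarDrawing {S} ρ =
    Σ Caterpillar λ C → let open Caterpillar C in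
    Σ (S → V) λ I → IsValidDrawing ρ dist I

  open import Algebra.Properties.Semiring.Sum semiring
  open IntegerCoefficients commutativeRing
    using (solve; _:=_; _:+_; _:*_; _:-_; :-_; con)
  open import Relation.Binary.Reasoning.Setoid setoid

  Matrix : ℕ → ℕ → Set
  Matrix m n = Fin m → Fin n → Carrier

  infixl 7 _*ᴹ_ _*ⱽ_
  infix 8 -ᴹ_
  infix 9 _ᵀ
  infix 4 _≈ᴹ_

  _*ᴹ_ : ∀ {k m n} → Matrix k m → Matrix m n → Matrix k n
  (M *ᴹ N) i j = sum λ c → M i c * N c j

  _*ⱽ_ : ∀ {m n} → Matrix m n → Vector Carrier n → Vector Carrier m
  (M *ⱽ x) i = sum λ c → M i c * x c

  -ᴹ_ : ∀ {m n} → Matrix m n → Matrix m n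
  (-ᴹ M) i j = - M i j

  _ᵀ : ∀ {m n} → Matrix m n → Matrix n m
  (M ᵀ) i j = M j i

  _≈ᴹ_ : ∀ {m n} → Rel (Matrix m n) 0ℓ
  M ≈ᴹ N = ∀ i j → M i j ≈ N i j

  1ᴹ : ∀ {n} → Matrix n n
  1ᴹ i j = if does (i Finₚ.≟ j) then 1# else 0#

  IsInverse : ∀ {n} → Matrix n n → Matrix n n → Set
  IsInverse M M⁻¹ = (M *ᴹ M⁻¹ ≈ᴹ 1ᴹ) × (M⁻¹ *ᴹ M ≈ᴹ 1ᴹ)

  Invertible : ∀ {n} → Matrix n n → Set
  Invertible M = ∃ (IsInverse M)

  ᵀ-invertible : ∀ {n} {M : Matrix n n} → Invertible M → Invertible (M ᵀ)
  ᵀ-invertible {n} {M} (M⁻¹ , r , l) =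
    M⁻¹ ᵀ , (λ i j → trans (sum-cong-≋ {n} λ c → *-comm _ _) (trans (l j i) (1ᴹ-sym j i))) ,
            (λ i j → trans (sum-cong-≋ {n} λ c → *-comm _ _) (trans (r j i) (1ᴹ-sym j i)))
    where
    1ᴹ-sym : ∀ {n} (i j : Fin n) → 1ᴹ i j ≈ 1ᴹ j i
    1ᴹ-sym zero    zero    = refl
    1ᴹ-sym zero    (suc j) = refl
    1ᴹ-sym (suc i) zero    = refl
    1ᴹ-sym (suc i) (suc j) = 1ᴹ-sym i j

  NonNegative : ∀ {n} → Vector Carrier n → Set
  NonNegative x = ∀ i → 0# ≤ x i

  IsZero : ∀ {n} → Vector Carrier n → Set
  IsZero x = ∀ i → x i ≈ 0#

  2# : Carrier
  2# = 1# + 1#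

  2≉0 : ¬ 2# ≈ 0#
  2≉0 2≈0 = irrefl (sym 2≈0)
    (<-trans 0<1 (<-respˡ-≈ (+-identityʳ 1#) (+-monoʳ-< 1# 0<1)))

  ½ : Carrier
  ½ = proj₁ (inverse 2# 2≉0)

  2*½ : ∀ x → 2# * (½ * (x - 0#)) ≈ x
  2*½ x = begin
    2# * (½ * (x - 0#)) ≈⟨ solve 2 (λ a y → con (+ 2) :* (a :* (y :- con (+ 0))) :=
                                            (con (+ 2) :* a) :* y) refl ½ x ⟩
    (2# * ½) * x        ≈⟨ *-congʳ (proj₂ (inverse 2# 2≉0)) ⟩
    1# * x              ≈⟨ *-identityˡ x ⟩
    x                   ∎

  ½+½ : ∀ x → ½ * x + ½ * x ≈ x
  ½+½ x = trans (solve 2 (λ a y → a :* y :+ a :* y :=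
                            con (+ 2) :* (a :* (y :- con (+ 0)))) refl ½ x) (2*½ x)

  sum-zero : ∀ {n} {f : Vector Carrier n} → (∀ i → f i ≈ 0#) → sum f ≈ 0#
  sum-zero {n} f≈0 = trans (sum-cong-≋ {n} f≈0) (sum-replicate-zero n)

  sum-++ : ∀ {m n} (f : Vector Carrier (m ℕ.+ n)) →
           sum f ≈ sum (λ i → f (i ↑ˡ n)) + sum (λ j → f (m ↑ʳ j))
  sum-++ {zero}  f = sym (+-identityˡ _)
  sum-++ {suc m} f = trans (+-congˡ (sum-++ {m} (f ∘ suc))) (sym (+-assoc _ _ _))

  sum-lin : ∀ {n} a (f g : Vector Carrier n) →
            sum (λ i → f i + a * g i) ≈ sum f + a * sum g
  sum-lin {n} a f g = trans (∑-distrib-+ {n} _ _) (+-congˡ (sym (*-distribˡ-sum {n} a g)))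

  sum-1ᴹ : ∀ {n} (a : Fin n) (x : Vector Carrier n) → sum (λ c → 1ᴹ a c * x c) ≈ x a
  sum-1ᴹ zero    x = trans (+-cong (*-identityˡ _) (sum-zero λ c → zeroˡ (x (suc c))))
                           (+-identityʳ _)
  sum-1ᴹ (suc a) x = trans (+-cong (zeroˡ _) (sum-1ᴹ a (x ∘ suc))) (+-identityˡ _)

  ∀-++ : ∀ {m n} (P : Fin (m ℕ.+ n) → Set) →
         (∀ i → P (i ↑ˡ n)) → (∀ j → P (m ↑ʳ j)) → ∀ i → P i
  ∀-++ {m} {n} P l r i with splitAt m i in eq
  ... | inj₁ a = ≡.subst P (Finₚ.splitAt⁻¹-↑ˡ eq) (l a)
  ... | inj₂ b = ≡.subst P (Finₚ.splitAt⁻¹-↑ʳ eq) (r b)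

  1ᴹ-↑ˡ : ∀ {m n} (i j : Fin m) → 1ᴹ (i ↑ˡ n) (j ↑ˡ n) ≡ 1ᴹ i j
  1ᴹ-↑ˡ zero    zero    = ≡.refl
  1ᴹ-↑ˡ zero    (suc j) = ≡.refl
  1ᴹ-↑ˡ (suc i) zero    = ≡.refl
  1ᴹ-↑ˡ (suc i) (suc j) = 1ᴹ-↑ˡ i j

  1ᴹ-↑ʳ : ∀ m {n} (i j : Fin n) → 1ᴹ (m ↑ʳ i) (m ↑ʳ j) ≡ 1ᴹ i j
  1ᴹ-↑ʳ zero    i j = ≡.refl
  1ᴹ-↑ʳ (suc m) i j = 1ᴹ-↑ʳ m i j

  1ᴹ-↑ˡ↑ʳ : ∀ {m n} (i : Fin m) (j : Fin n) → 1ᴹ (i ↑ˡ n) (m ↑ʳ j) ≡ 0#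
  1ᴹ-↑ˡ↑ʳ zero    j = ≡.refl
  1ᴹ-↑ˡ↑ʳ (suc i) j = 1ᴹ-↑ˡ↑ʳ i j

  1ᴹ-↑ʳ↑ˡ : ∀ {m n} (i : Fin n) (j : Fin m) → 1ᴹ (m ↑ʳ i) (j ↑ˡ n) ≡ 0#
  1ᴹ-↑ʳ↑ˡ i zero    = ≡.refl
  1ᴹ-↑ʳ↑ˡ i (suc j) = 1ᴹ-↑ʳ↑ˡ i j

  step : ∀ {p} → Fin p → Fin (suc p) → Carrier
  step b i = if toℕ b ℕ.<ᵇ toℕ i then ½ else 0#

  step-diff : ∀ {p} (k b : Fin p) → step b (suc k) - step b (inject₁ k) ≈ ½ * 1ᴹ k b
  step-diff zero    zero    = solve 1 (λ a → a :- con (+ 0) := a :* con (+ 1)) refl ½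
  step-diff zero    (suc b) = solve 1 (λ a → con (+ 0) :- con (+ 0) := a :* con (+ 0)) refl ½
  step-diff (suc k) zero    = solve 1 (λ a → a :- a := a :* con (+ 0)) refl ½
  step-diff (suc k) (suc b) = step-diff k b

  telescope : ∀ {p} (g : Fin (suc p) → Carrier) (k : Fin p) →
              sum (λ a → step a (suc k) * (g (suc a) - g (inject₁ a))) ≈
              ½ * (g (suc k) - g zero)
  telescope {suc p} g zero = trans (+-congˡ (sum-zero {p} λ a → zeroˡ _)) (+-identityʳ _)
  telescope g (suc k) = trans (+-congˡ (telescope (g ∘ suc) k))
    (solve 4 (λ a x y z → a :* (y :- x) :+ a :* (z :- y) := a :* (z :- x)) refl _ _ _ _)

  -- Here n = p + 1, the points 1, …, n are the elements of Fin (suc p), and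
  -- the 2n - 2 columns are h₂, …, hₙ, l₂, …, lₙ in this order.
  module _ {p : ℕ} where

    Form : Set
    Form = Vector Carrier (p ℕ.+ p)

    h l : Fin (suc p) → Form
    h zero    = λ _ → 0#
    h (suc k) = 1ᴹ (k ↑ˡ p)
    l zero    = λ _ → 0#
    l (suc k) = 1ᴹ (p ↑ʳ k)

    -- (n - 1)(n - 2) pairs, in lexicographic order.
    nonconsecutivePairs : List (Fin (suc p) × Fin (suc p))
    nonconsecutivePairs =
      filter (λ (i , j) → 1 ℕₚ.<? ∣ toℕ i - toℕ j ∣)
             (cartesianProduct (allFin (suc p)) (allFin (suc p)))

    #N : ℕ
    #N = length nonconsecutivePairs

    module _ (ρ : Fin (suc p) → Fin (suc p) → Carrier) where

      open Extrema (Finₚ.≤-totalOrder (suc p)) using (max; min; argmax-sel; argmin-sel)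

      CloserToFirst CloserToLast : (i k j : Fin (suc p)) → Set
      CloserToFirst i k j = i Fin.≤ j × j Fin.≤ k × ρ i j < ρ j k
      CloserToLast  i k j = i Fin.≤ j × j Fin.≤ k × ρ j k < ρ i j

      closerToFirst? : ∀ i k j → Dec (CloserToFirst i k j)
      closerToFirst? i k j =
        (i Finₚ.≤? j) ×-dec (j Finₚ.≤? k) ×-dec (ρ i j <? ρ j k)

      closerToLast? : ∀ i k j → Dec (CloserToLast i k j)
      closerToLast? i k j =
        (i Finₚ.≤? j) ×-dec (j Finₚ.≤? k) ×-dec (ρ j k <? ρ i j)

      -- For i < k the seeds i of max and k of min belong to the respective
      -- sets, because 0 = ρ i i < ρ i k and ρ k k = 0 < ρ i k.
      L R : Fin (suc p) → Fin (suc p) → Fin (suc p)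
      L i k = max i (filter (closerToFirst? i k) (allFin (suc p)))
      R k i = min k (filter (closerToLast? i k) (allFin (suc p)))

      -- Row (i, j) of A; the pairs (i, i) do not index rows, and their value
      -- is never used.
      A : Fin (suc p) → Fin (suc p) → Form
      A i j c with Finₚ.<-cmp i j
      ... | tri< _ _ _ = h i c + h j c - 2# * h (L i j) c - l i c + l j c
      ... | tri> _ _ _ = - h j c - h i c + 2# * h (R i j) c + l j c - l i c
      ... | tri≈ _ _ _ = 0#

      B : Matrix (p ℕ.+ p) (p ℕ.+ p)
      B = (λ k → A (inject₁ k) (suc k)) ++ (λ k → A (suc k) (inject₁ k))

      N : Matrix #N (p ℕ.+ p)
      N q = let (i , j) = List.lookup nonconsecutivePairs q in A i j

      module _ (dis : IsDissimilarity ρ) where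

        open IsDissimilarity dis

        ρ≮ρ-diag : ∀ x y z → ¬ ρ x y < ρ z z
        ρ≮ρ-diag x y z lt with nonneg x y
        ... | inj₁ 0<ρ = <-asym 0<ρ (<-respʳ-≈ (ρ-diag z) lt)
        ... | inj₂ 0≈ρ = irrefl (sym 0≈ρ) (<-respʳ-≈ (ρ-diag z) lt)

        between : ∀ k (j : Fin (suc p)) → inject₁ k Fin.≤ j → j Fin.≤ suc k →
                  (j ≡ inject₁ k) ⊎ (j ≡ suc k)
        between k j i≤j j≤k with ℕₚ.m≤n⇒m<n∨m≡n i≤j
        ... | inj₂ i≡j = inj₁ (≡.sym (Finₚ.toℕ-injective i≡j))
        ... | inj₁ i<j = inj₂ (Finₚ.toℕ-injective (ℕₚ.≤-antisym j≤k
                (≡.subst (ℕ._< toℕ j) (Finₚ.toℕ-inject₁ k) i<j)))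

        L-consecutive : ∀ k → L (inject₁ k) (suc k) ≡ inject₁ k
        L-consecutive k
          with argmax-sel (λ j → j) (inject₁ k)
                 (filter (closerToFirst? (inject₁ k) (suc k)) (allFin (suc p)))
        ... | inj₁ eq = eq
        ... | inj₂ L∈
          with ∈-filter⁻ (closerToFirst? (inject₁ k) (suc k)) {xs = allFin (suc p)} L∈
        ... | _ , i≤L , L≤k , lt with between k _ i≤L L≤k
        ... | inj₁ eq = eq
        ... | inj₂ eq = ⊥-elim (ρ≮ρ-diag (inject₁ k) (L (inject₁ k) (suc k)) (suc k)
              (≡.subst (λ j → ρ (inject₁ k) (L (inject₁ k) (suc k)) < ρ j (suc k)) eq lt))

        R-consecutive : ∀ k → R (suc k) (inject₁ k) ≡ suc k
        R-consecutive k
          with argmin-sel (λ j → j) (suc k)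
                 (filter (closerToLast? (inject₁ k) (suc k)) (allFin (suc p)))
        ... | inj₁ eq = eq
        ... | inj₂ R∈
          with ∈-filter⁻ (closerToLast? (inject₁ k) (suc k)) {xs = allFin (suc p)} R∈
        ... | _ , i≤R , R≤k , lt with between k _ i≤R R≤k
        ... | inj₂ eq = eq
        ... | inj₁ eq = ⊥-elim (ρ≮ρ-diag (R (suc k) (inject₁ k)) (suc k) (inject₁ k)
              (≡.subst (λ j → ρ (R (suc k) (inject₁ k)) (suc k) < ρ (inject₁ k) j) eq lt))

        inject₁<suc : ∀ (k : Fin p) → inject₁ k Fin.< suc k
        inject₁<suc k = ℕₚ.≤-reflexive (≡.cong suc (Finₚ.toℕ-inject₁ k))

        Δh Δl : Fin p → Form
        Δh k c = h (suc k) c - h (inject₁ k) c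
        Δl k c = l (suc k) c - l (inject₁ k) c

        A-up : ∀ k c → A (inject₁ k) (suc k) c ≈ Δh k c + Δl k c
        A-up k c with Finₚ.<-cmp (inject₁ k) (suc k)
        ... | tri< _ _ _ rewrite L-consecutive k =
          solve 4 (λ x y s t →
                    x :+ y :- con (+ 2) :* x :- s :+ t := (y :- x) :+ (t :- s))
                refl _ _ _ _
        ... | tri≈ ≮ _ _ = ⊥-elim (≮ (inject₁<suc k))
        ... | tri> ≮ _ _ = ⊥-elim (≮ (inject₁<suc k))

        A-down : ∀ k c → A (suc k) (inject₁ k) c ≈ Δh k c - Δl k c
        A-down k c with Finₚ.<-cmp (suc k) (inject₁ k)
        ... | tri> _ _ _ rewrite R-consecutive k =
          solve 4 (λ x y s t →
                    :- x :- y :+ con (+ 2) :* y :+ s :- t := (y :- x) :- (t :- s))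
                refl _ _ _ _
        ... | tri≈ _ _ ≯ = ⊥-elim (≯ (inject₁<suc k))
        ... | tri< _ _ ≯ = ⊥-elim (≯ (inject₁<suc k))

        -- h_{k+1} and l_{k+1} are half the sum, respectively half the
        -- difference, of the first k rows (a, a + 1) and (a + 1, a).
        B⁻¹ : Matrix (p ℕ.+ p) (p ℕ.+ p)
        B⁻¹ = rowʰ ++ rowˡ
          where
          rowʰ rowˡ : Fin p → Form
          rowʰ k = (λ a → step a (suc k)) ++ (λ a → step a (suc k))
          rowˡ k = (λ a → step a (suc k)) ++ (λ a → - step a (suc k))

        B-up : ∀ k c → B (k ↑ˡ p) c ≈ Δh k c + Δl k c
        B-up k c rewrite Finₚ.splitAt-↑ˡ p k p = A-up k c

        B-down : ∀ k c → B (p ↑ʳ k) c ≈ Δh k c - Δl k c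
        B-down k c rewrite Finₚ.splitAt-↑ʳ p p k = A-down k c

        B⁻¹-hu : ∀ k a → B⁻¹ (k ↑ˡ p) (a ↑ˡ p) ≡ step a (suc k)
        B⁻¹-hu k a rewrite Finₚ.splitAt-↑ˡ p k p | Finₚ.splitAt-↑ˡ p a p = ≡.refl

        B⁻¹-hd : ∀ k a → B⁻¹ (k ↑ˡ p) (p ↑ʳ a) ≡ step a (suc k)
        B⁻¹-hd k a rewrite Finₚ.splitAt-↑ˡ p k p | Finₚ.splitAt-↑ʳ p p a = ≡.refl

        B⁻¹-lu : ∀ k a → B⁻¹ (p ↑ʳ k) (a ↑ˡ p) ≡ step a (suc k)
        B⁻¹-lu k a rewrite Finₚ.splitAt-↑ʳ p p k | Finₚ.splitAt-↑ˡ p a p = ≡.refl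

        B⁻¹-ld : ∀ k a → B⁻¹ (p ↑ʳ k) (p ↑ʳ a) ≡ - step a (suc k)
        B⁻¹-ld k a rewrite Finₚ.splitAt-↑ʳ p p k | Finₚ.splitAt-↑ʳ p p a = ≡.refl

        module _ (x : Form) (α β : Fin (suc p) → Carrier)
                 (α₀ : α zero ≈ 0#) (β₀ : β zero ≈ 0#)
                 (x-h : ∀ k → x (k ↑ˡ p) ≈ α (suc k))
                 (x-l : ∀ k → x (p ↑ʳ k) ≈ β (suc k)) where

          eval-h : ∀ i → sum (λ c → h i c * x c) ≈ α i
          eval-h zero    = trans (sum-zero λ c → zeroˡ (x c)) (sym α₀)
          eval-h (suc k) = trans (sum-1ᴹ (k ↑ˡ p) x) (x-h k)

          eval-l : ∀ i → sum (λ c → l i c * x c) ≈ β i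
          eval-l zero    = trans (sum-zero λ c → zeroˡ (x c)) (sym β₀)
          eval-l (suc k) = trans (sum-1ᴹ (p ↑ʳ k) x) (x-l k)

          eval-up : ∀ k → sum (λ c → B (k ↑ˡ p) c * x c) ≈
                    (α (suc k) - α (inject₁ k)) + (β (suc k) - β (inject₁ k))
          eval-up k = begin
            sum (λ c → B (k ↑ˡ p) c * x c)
              ≈⟨ sum-cong-≋ {p ℕ.+ p} (λ c → trans (*-congʳ (B-up k c)) (solve 5
                   (λ a b s t y → ((a :- b) :+ (s :- t)) :* y :=
                     (a :* y :+ (:- con (+ 1)) :* (b :* y)) :+ (s :* y :+ (:- con (+ 1)) :* (t :* y)))
                   refl _ _ _ _ (x c))) ⟩
            sum (λ c → (h (suc k) c * x c + (- 1#) * (h (inject₁ k) c * x c)) +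
                       (l (suc k) c * x c + (- 1#) * (l (inject₁ k) c * x c)))
              ≈⟨ trans (∑-distrib-+ {p ℕ.+ p} _ _) (+-cong
                   (sum-lin {p ℕ.+ p} (- 1#) _ _) (sum-lin {p ℕ.+ p} (- 1#) _ _)) ⟩
            (sum (λ c → h (suc k) c * x c) + (- 1#) * sum (λ c → h (inject₁ k) c * x c)) +
            (sum (λ c → l (suc k) c * x c) + (- 1#) * sum (λ c → l (inject₁ k) c * x c))
              ≈⟨ +-cong (+-cong (eval-h _) (*-congˡ (eval-h _)))
                        (+-cong (eval-l _) (*-congˡ (eval-l _))) ⟩
            (α (suc k) + (- 1#) * α (inject₁ k)) + (β (suc k) + (- 1#) * β (inject₁ k))
              ≈⟨ solve 4 (λ a b s t →
                   (a :+ (:- con (+ 1)) :* b) :+ (s :+ (:- con (+ 1)) :* t) := (a :- b) :+ (s :- t))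
                   refl _ _ _ _ ⟩
            (α (suc k) - α (inject₁ k)) + (β (suc k) - β (inject₁ k)) ∎

          eval-down : ∀ k → sum (λ c → B (p ↑ʳ k) c * x c) ≈
                      (α (suc k) - α (inject₁ k)) - (β (suc k) - β (inject₁ k))
          eval-down k = begin
            sum (λ c → B (p ↑ʳ k) c * x c)
              ≈⟨ sum-cong-≋ {p ℕ.+ p} (λ c → trans (*-congʳ (B-down k c)) (solve 5
                   (λ a b s t y → ((a :- b) :- (s :- t)) :* y :=
                     (a :* y :+ (:- con (+ 1)) :* (b :* y)) :+ (t :* y :+ (:- con (+ 1)) :* (s :* y)))
                   refl _ _ _ _ (x c))) ⟩
            sum (λ c → (h (suc k) c * x c + (- 1#) * (h (inject₁ k) c * x c)) +
                       (l (inject₁ k) c * x c + (- 1#) * (l (suc k) c * x c)))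
              ≈⟨ trans (∑-distrib-+ {p ℕ.+ p} _ _) (+-cong
                   (sum-lin {p ℕ.+ p} (- 1#) _ _) (sum-lin {p ℕ.+ p} (- 1#) _ _)) ⟩
            (sum (λ c → h (suc k) c * x c) + (- 1#) * sum (λ c → h (inject₁ k) c * x c)) +
            (sum (λ c → l (inject₁ k) c * x c) + (- 1#) * sum (λ c → l (suc k) c * x c))
              ≈⟨ +-cong (+-cong (eval-h _) (*-congˡ (eval-h _)))
                        (+-cong (eval-l _) (*-congˡ (eval-l _))) ⟩
            (α (suc k) + (- 1#) * α (inject₁ k)) + (β (inject₁ k) + (- 1#) * β (suc k))
              ≈⟨ solve 4 (λ a b s t →
                   (a :+ (:- con (+ 1)) :* b) :+ (t :+ (:- con (+ 1)) :* s) := (a :- b) :- (s :- t))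
                   refl _ _ _ _ ⟩
            (α (suc k) - α (inject₁ k)) - (β (suc k) - β (inject₁ k)) ∎

        B*B⁻¹ : B *ᴹ B⁻¹ ≈ᴹ 1ᴹ
        B*B⁻¹ r s = ∀-++ (λ r → (B *ᴹ B⁻¹) r s ≈ 1ᴹ r s)
          (λ k → ∀-++ (λ s → (B *ᴹ B⁻¹) (k ↑ˡ p) s ≈ 1ᴹ (k ↑ˡ p) s)
            (λ b → trans (up-u k b) (sym (reflexive (1ᴹ-↑ˡ k b))))
            (λ b → trans (up-d k b) (sym (reflexive (1ᴹ-↑ˡ↑ʳ k b)))) s)
          (λ k → ∀-++ (λ s → (B *ᴹ B⁻¹) (p ↑ʳ k) s ≈ 1ᴹ (p ↑ʳ k) s)
            (λ b → trans (down-u k b) (sym (reflexive (1ᴹ-↑ʳ↑ˡ k b))))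
            (λ b → trans (down-d k b) (sym (reflexive (1ᴹ-↑ʳ p k b)))) s)
          r
          where
          neg-step : Fin p → Fin (suc p) → Carrier
          neg-step b i = - step b i

          neg₀ : ∀ b → neg-step b zero ≈ 0#
          neg₀ b = solve 0 (:- con (+ 0) := con (+ 0)) refl

          neg-diff : ∀ k b → neg-step b (suc k) - neg-step b (inject₁ k) ≈ - (½ * 1ᴹ k b)
          neg-diff k b = trans
            (solve 2 (λ x y → :- x :- :- y := :- (x :- y)) refl _ _)
            (-‿cong (step-diff k b))

          up-u : ∀ k b → sum (λ c → B (k ↑ˡ p) c * B⁻¹ c (b ↑ˡ p)) ≈ 1ᴹ k b
          up-u k b = trans
            (eval-up _ (step b) (step b) refl refl
              (λ c → reflexive (B⁻¹-hu c b)) (λ c → reflexive (B⁻¹-lu c b)) k)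
            (trans (+-cong (step-diff k b) (step-diff k b)) (½+½ _))

          up-d : ∀ k b → sum (λ c → B (k ↑ˡ p) c * B⁻¹ c (p ↑ʳ b)) ≈ 0#
          up-d k b = trans
            (eval-up _ (step b) (neg-step b) refl (neg₀ b)
              (λ c → reflexive (B⁻¹-hd c b)) (λ c → reflexive (B⁻¹-ld c b)) k)
            (trans (+-cong (step-diff k b) (neg-diff k b)) (-‿inverseʳ _))

          down-u : ∀ k b → sum (λ c → B (p ↑ʳ k) c * B⁻¹ c (b ↑ˡ p)) ≈ 0#
          down-u k b = trans
            (eval-down _ (step b) (step b) refl refl
              (λ c → reflexive (B⁻¹-hu c b)) (λ c → reflexive (B⁻¹-lu c b)) k)
            (-‿inverseʳ _)

          down-d : ∀ k b → sum (λ c → B (p ↑ʳ k) c * B⁻¹ c (p ↑ʳ b)) ≈ 1ᴹ k b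
          down-d k b = trans
            (eval-down _ (step b) (neg-step b) refl (neg₀ b)
              (λ c → reflexive (B⁻¹-hd c b)) (λ c → reflexive (B⁻¹-ld c b)) k)
            (trans (+-cong (step-diff k b) (-‿cong (neg-diff k b)))
              (trans (solve 1 (λ x → x :- :- x := x :+ x) refl _) (½+½ _)))

        B⁻¹*B : B⁻¹ *ᴹ B ≈ᴹ 1ᴹ
        B⁻¹*B r s = ∀-++ (λ r → (B⁻¹ *ᴹ B) r s ≈ 1ᴹ r s)
          (λ k → begin
            sum (λ c → B⁻¹ (k ↑ˡ p) c * B c s)
              ≈⟨ sum-++ {p} {p} (λ c → B⁻¹ (k ↑ˡ p) c * B c s) ⟩
            sum (λ a → B⁻¹ (k ↑ˡ p) (a ↑ˡ p) * B (a ↑ˡ p) s) +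
            sum (λ a → B⁻¹ (k ↑ˡ p) (p ↑ʳ a) * B (p ↑ʳ a) s)
              ≈⟨ ∑-distrib-+ {p} _ _ ⟨
            sum (λ a → B⁻¹ (k ↑ˡ p) (a ↑ˡ p) * B (a ↑ˡ p) s +
                       B⁻¹ (k ↑ˡ p) (p ↑ʳ a) * B (p ↑ʳ a) s)
              ≈⟨ sum-cong-≋ {p} (λ a → trans
                   (+-cong (*-cong (reflexive (B⁻¹-hu k a)) (B-up a s))
                           (*-cong (reflexive (B⁻¹-hd k a)) (B-down a s)))
                   (solve 3 (λ q x y → q :* (x :+ y) :+ q :* (x :- y) :=
                                       con (+ 2) :* (q :* x)) refl _ _ _)) ⟩
            sum (λ a → 2# * (step a (suc k) * Δh a s))
              ≈⟨ *-distribˡ-sum {p} 2# _ ⟨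
            2# * sum (λ a → step a (suc k) * Δh a s)
              ≈⟨ *-congˡ (telescope (λ i → h i s) k) ⟩
            2# * (½ * (1ᴹ (k ↑ˡ p) s - 0#))
              ≈⟨ 2*½ _ ⟩
            1ᴹ (k ↑ˡ p) s ∎)
          (λ k → begin
            sum (λ c → B⁻¹ (p ↑ʳ k) c * B c s)
              ≈⟨ sum-++ {p} {p} (λ c → B⁻¹ (p ↑ʳ k) c * B c s) ⟩
            sum (λ a → B⁻¹ (p ↑ʳ k) (a ↑ˡ p) * B (a ↑ˡ p) s) +
            sum (λ a → B⁻¹ (p ↑ʳ k) (p ↑ʳ a) * B (p ↑ʳ a) s)
              ≈⟨ ∑-distrib-+ {p} _ _ ⟨
            sum (λ a → B⁻¹ (p ↑ʳ k) (a ↑ˡ p) * B (a ↑ˡ p) s +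
                       B⁻¹ (p ↑ʳ k) (p ↑ʳ a) * B (p ↑ʳ a) s)
              ≈⟨ sum-cong-≋ {p} (λ a → trans
                   (+-cong (*-cong (reflexive (B⁻¹-lu k a)) (B-up a s))
                           (*-cong (reflexive (B⁻¹-ld k a)) (B-down a s)))
                   (solve 3 (λ q x y → q :* (x :+ y) :+ (:- q) :* (x :- y) :=
                                       con (+ 2) :* (q :* y)) refl _ _ _)) ⟩
            sum (λ a → 2# * (step a (suc k) * Δl a s))
              ≈⟨ *-distribˡ-sum {p} 2# _ ⟨
            2# * sum (λ a → step a (suc k) * Δl a s)
              ≈⟨ *-congˡ (telescope (λ i → l i s) k) ⟩
            2# * (½ * (1ᴹ (p ↑ʳ k) s - 0#))
              ≈⟨ 2*½ _ ⟩
            1ᴹ (p ↑ʳ k) s ∎)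
          r

        B-invertible : Invertible B
        B-invertible = B⁻¹ , B*B⁻¹ , B⁻¹*B

        Bᵀ-invertible : Invertible (B ᵀ)
        Bᵀ-invertible = ᵀ-invertible B-invertible

        Y : Matrix (p ℕ.+ p) #N
        Y = -ᴹ (proj₁ Bᵀ-invertible *ᴹ N ᵀ)

-- A drawing in a tree solves A x > 0: put U i = d 1 i, V i = d i n and take
-- h i = U i - V i, l i = U i + V i.  In a tree U i < U j and V j < V i force
-- U j + V i = d 1 n + d i j (four-point condition), so the row of (i , j) equals
-- 2 (d c j - d i c) with c = L (i , j), which validity makes positive; at the
-- end points monotonicity of U and V is enough.  Conversely, if A x > 0, hang a
-- leaf at distance l i + const from the point h i of the spine.  Since h + l,
-- h - l and h are increasing, distances to points on one side of a leaf compare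
-- correctly, and the rows handle points on different sides.  Finally A x > 0 is
-- solvable exactly when the system for y is infeasible, by Fourier–Motzkin
-- elimination applied to z = B x, in terms of which N x = - Yᵀ z.

module Submission where

open import Data.Empty using (⊥; ⊥-elim)
open import Data.Fin.Base as Fin
  using (Fin; zero; suc; toℕ; inject₁; fromℕ; splitAt; _↑ˡ_; _↑ʳ_) renaming (_<_ to _<ᶠ_)
open import Data.Fin.Induction using (<-weakInduction-startingFrom)
import Data.Fin.Properties as Finₚ
open import Data.Integer.Base using (+_)
open import Data.List.Base as List
  using (List; []; _∷_; map; filter; allFin; cartesianProduct; cartesianProductWith)
import Data.List.Extrema as Extrema
open import Data.List.Membership.Propositional using (_∈_)
open import Data.List.Membership.Propositional.Properties
  using (∈-map⁺; ∈-map⁻; ∈-filter⁺; ∈-filter⁻; ∈-++⁺ˡ; ∈-++⁺ʳ; ∈-++⁻; ∈-allFin; ∈-lookup;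
         ∈-cartesianProduct⁺; ∈-cartesianProductWith⁺; ∈-cartesianProductWith⁻)
import Data.List.Relation.Unary.All as All
open import Data.List.Relation.Unary.Any using (here; there; index)
open import Data.List.Relation.Unary.Any.Properties using (lookup-index)
open import Data.Nat.Base as ℕ using (ℕ; zero; suc)
import Data.Nat.Properties as ℕₚ
open import Data.Product.Base using (Σ; ∃; _×_; _,_; proj₁; proj₂)
open import Data.Sum.Base using (_⊎_; inj₁; inj₂; [_,_]′; swap)
open import Data.Vec.Functional as Vector using (Vector)
import Data.Vec.Functional.Properties as Vectorₚ
open import Function.Base using (_∘_; id)
open import Function.Bundles using (_⇔_; mk⇔; module Equivalence)
open import Function.Definitions using (Injective)
open import Level using (0ℓ)
open import Relation.Binary.Construct.Closure.ReflexiveTransitive as Star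
  using (Star; ε; _◅_; _◅◅_)
import Relation.Binary.Construct.StrictToNonStrict as StrictToNonStrict
open import Relation.Binary.Core using (Rel)
open import Relation.Binary.Definitions using (Tri; tri<; tri≈; tri>)
open import Relation.Binary.PropositionalEquality as ≡ using (_≡_; _≢_)
open import Relation.Nullary.Decidable using (Dec; yes; no; _×-dec_; _⊎-dec_; map′)
open import Relation.Nullary.Negation using (¬_)
open import Defs

-- Suppose that in a tree the image of `i` projects to position `a` on the path from the image of 1
-- to that of n, which has length `D`, and lies at distance `b` from this path. Then `U i` is a + b
-- and `V i` is D - a + b. So `h` and `l` are twice the spine coordinate and twice the leg, up to
-- additive constants: a solution of the rows already describes a caterpillar, and the factor is
-- harmless because the rows are homogeneous. For i < c < j the leg of `c` cancels in the difference
-- of its distances to `j` and to `i`, which is why a row contains no `l` of its centre. One row per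
-- ordered pair is enough. Since `h` is increasing, among all `c` closer to `i` the row is smallest
-- at the last one, L (i , j), and dually for R. The consecutive rows supply this monotonicity. The
-- points of a drawing may lie anywhere in the tree. Projections are nevertheless never formed: the
-- four-point equality comes from a single edge whose removal separates the points in question.

module OrderedField (ℝ : RealNumbers) where

  open RealNumbers ℝ hiding (zero)
  open IntegerCoefficients commutativeRing public
    using (solve; _:=_; _:+_; _:*_; _:-_; :-_; con)
  open Definitions ℝ using (½; 2#; 2≉0; ½+½; NonNegative; IsZero)
  open import Algebra.Properties.Semiring.Sum semiring
  private module ≤ = StrictToNonStrict _≈_ _<_

  -- Order arithmetic in an ordered field.

  ≤-refl : ∀ {x} → x ≤ x
  ≤-refl = inj₂ refl

  ≤-trans : ∀ {x y z} → x ≤ y → y ≤ z → x ≤ z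
  ≤-trans = ≤.trans isEquivalence (<-respʳ-≈ , <-respˡ-≈) <-trans

  <-≤-trans : ∀ {x y z} → x < y → y ≤ z → x < z
  <-≤-trans = ≤.<-≤-trans <-trans <-respʳ-≈

  ≤-<-trans : ∀ {x y z} → x ≤ y → y < z → x < z
  ≤-<-trans = ≤.≤-<-trans sym <-trans <-respˡ-≈

  ≤-antisym : ∀ {x y} → x ≤ y → y ≤ x → x ≈ y
  ≤-antisym = ≤.antisym isEquivalence <-trans irrefl

  ≮⇒≥ : ∀ {x y} → ¬ x < y → y ≤ x
  ≮⇒≥ {x} {y} x≮y with compare x y
  ... | tri< x<y _ _ = ⊥-elim (x≮y x<y)
  ... | tri≈ _ x≈y _ = inj₂ (sym x≈y)
  ... | tri> _ _ y<x = inj₁ y<x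

  <⇒≱ : ∀ {x y} → x < y → ¬ y ≤ x
  <⇒≱ x<y y≤x = irrefl refl (<-≤-trans x<y y≤x)

  +-monoˡ-< : ∀ z {x y} → x < y → x + z < y + z
  +-monoˡ-< z x<y = <-respˡ-≈ (+-comm z _) (<-respʳ-≈ (+-comm z _) (+-monoʳ-< z x<y))

  infixl 6 _<+<_ _≤+≤_ _<+≤_ _≤+<_

  _<+<_ : ∀ {x y u v} → x < y → u < v → x + u < y + v
  x<y <+< u<v = <-trans (+-monoˡ-< _ x<y) (+-monoʳ-< _ u<v)

  _<+≤_ : ∀ {x y u v} → x < y → u ≤ v → x + u < y + v
  x<y <+≤ inj₁ u<v = x<y <+< u<v
  x<y <+≤ inj₂ u≈v = <-respʳ-≈ (+-congˡ u≈v) (+-monoˡ-< _ x<y)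

  _≤+<_ : ∀ {x y u v} → x ≤ y → u < v → x + u < y + v
  inj₁ x<y ≤+< u<v = x<y <+< u<v
  inj₂ x≈y ≤+< u<v = <-respʳ-≈ (+-congʳ x≈y) (+-monoʳ-< _ u<v)

  _≤+≤_ : ∀ {x y u v} → x ≤ y → u ≤ v → x + u ≤ y + v
  inj₁ x<y ≤+≤ u≤v      = inj₁ (x<y <+≤ u≤v)
  inj₂ x≈y ≤+≤ inj₁ u<v = inj₁ (inj₂ x≈y ≤+< u<v)
  inj₂ x≈y ≤+≤ inj₂ u≈v = inj₂ (+-cong x≈y u≈v)

  -- Linear inequalities are derived by adding up hypotheses and comparing
  -- the differences of the two sides with the ring solver.
  by-< : ∀ {x y u v} → u < v → v - u ≈ y - x → x < y
  by-< {x} {y} {u} {v} u<v eq =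
    <-respˡ-≈ (solve 2 (λ u x → u :+ (x :- u) := x) refl u x)
      (<-respʳ-≈ (trans (solve 3 (λ u v x → v :+ (x :- u) := (v :- u) :+ x) refl u v x)
        (trans (+-congʳ eq) (solve 2 (λ x y → (y :- x) :+ x := y) refl x y)))
        (+-monoˡ-< (x - u) u<v))

  by-≤ : ∀ {x y u v} → u ≤ v → v - u ≈ y - x → x ≤ y
  by-≤ (inj₁ u<v) eq = inj₁ (by-< u<v eq)
  by-≤ {x} {y} {u} {v} (inj₂ u≈v) eq = inj₂ (sym
    (trans (solve 2 (λ x y → y := (y :- x) :+ x) refl x y)
    (trans (+-congʳ (trans (sym eq) (trans (+-congʳ (sym u≈v)) (-‿inverseʳ u)))) (+-identityˡ x))))

  absurd-< : ∀ {x y} → x < y → y - x ≈ 0# → ⊥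
  absurd-< x<y eq = irrefl refl (by-< {0#} {0#} x<y
    (trans eq (solve 0 (con (+ 0) := con (+ 0) :- con (+ 0)) refl)))

  <⇒0<- : ∀ {x y} → x < y → 0# < y - x
  <⇒0<- x<y = by-< x<y (solve 2 (λ x y → y :- x := (y :- x) :- con (+ 0)) refl _ _)

  ≤⇒0≤- : ∀ {x y} → x ≤ y → 0# ≤ y - x
  ≤⇒0≤- x≤y = by-≤ x≤y (solve 2 (λ x y → y :- x := (y :- x) :- con (+ 0)) refl _ _)

  0<-+ : ∀ {x y} → 0# < x → 0# < y → 0# < x + y
  0<-+ p q = <-respˡ-≈ (+-identityˡ 0#) (p <+< q)

  0≤-+ : ∀ {x y} → 0# ≤ x → 0# ≤ y → 0# ≤ x + y
  0≤-+ p q = ≤-trans (inj₂ (sym (+-identityˡ 0#))) (p ≤+≤ q)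

  0<0-- : ∀ {x} → x < 0# → 0# < - x
  0<0-- x<0 = <-respʳ-≈ (+-identityˡ _) (<⇒0<- x<0)

  *-nonneg : ∀ {x y} → 0# ≤ x → 0# ≤ y → 0# ≤ x * y
  *-nonneg (inj₁ 0<x) (inj₁ 0<y) = inj₁ (*-pos 0<x 0<y)
  *-nonneg (inj₁ 0<x) (inj₂ 0≈y) = inj₂ (trans (sym (zeroʳ _)) (*-congˡ 0≈y))
  *-nonneg (inj₂ 0≈x) _          = inj₂ (trans (sym (zeroˡ _)) (*-congʳ 0≈x))

  *-cancel-pos : ∀ {x y} → 0# < x → 0# < x * y → 0# < y
  *-cancel-pos {x} {y} 0<x 0<xy with compare 0# y
  ... | tri< 0<y _ _ = 0<y
  ... | tri≈ _ 0≈y _ = ⊥-elim (irrefl (trans (sym (zeroʳ x)) (*-congˡ 0≈y)) 0<xy)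
  ... | tri> _ _ y<0 = ⊥-elim (absurd-< (0<-+ 0<xy (*-pos 0<x (0<0-- y<0)))
    (solve 2 (λ x y → (x :* y :+ x :* (:- y)) :- con (+ 0) := con (+ 0)) refl x y))

  0<2 : 0# < 2#
  0<2 = 0<-+ 0<1 0<1

  half-pos : ∀ {x} → 0# < 2# * x → 0# < x
  half-pos = *-cancel-pos 0<2

  0<½ : 0# < ½
  0<½ = half-pos (<-respʳ-≈ (sym (proj₂ (inverse 2# 2≉0))) 0<1)

  dense : ∀ {x y} → x < y → ∃ λ t → x < t × t < y
  dense {x} {y} x<y = ½ * x + ½ * y ,
    by-< 0<d (trans (solve 3 (λ a x y → a :* (y :- x) :- con (+ 0) :=
      (a :* x :+ a :* y) :- (a :* x :+ a :* x)) refl ½ x y) (+-congˡ (-‿cong (½+½ x)))) ,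
    by-< 0<d (trans (solve 3 (λ a x y → a :* (y :- x) :- con (+ 0) :=
      (a :* y :+ a :* y) :- (a :* x :+ a :* y)) refl ½ x y) (+-congʳ (½+½ y)))
    where
    0<d = *-pos 0<½ (<⇒0<- x<y)

  above : ∀ x → x < x + 1#
  above x = <-respˡ-≈ (+-identityʳ x) (+-monoʳ-< x 0<1)

  -- Absolute value and finite sums.

  ∣_∣ : Carrier → Carrier
  ∣ x ∣ with x <? 0#
  ... | yes _ = - x
  ... | no  _ = x

  abs-split : ∀ x → (∣ x ∣ ≈ x × 0# ≤ x) ⊎ (∣ x ∣ ≈ - x × x < 0#)
  abs-split x with x <? 0#
  ... | yes x<0 = inj₂ (refl , x<0)
  ... | no  x≮0 = inj₁ (refl , ≮⇒≥ x≮0)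

  private
    -≤ : ∀ {x} → x < 0# → x ≤ - x
    -≤ x<0 = inj₁ (<-trans x<0 (0<0-- x<0))

    ≤- : ∀ {x} → 0# ≤ x → - x ≤ x
    ≤- 0≤x = by-≤ (0≤x ≤+≤ 0≤x) (solve 1 (λ x →
      (x :+ x) :- (con (+ 0) :+ con (+ 0)) := x :- :- x) refl _)

  x≤∣x∣ : ∀ x → x ≤ ∣ x ∣
  x≤∣x∣ x with abs-split x
  ... | inj₁ (eq , _)   = inj₂ (sym eq)
  ... | inj₂ (eq , x<0) = ≤-trans (-≤ x<0) (inj₂ (sym eq))

  -x≤∣x∣ : ∀ x → - x ≤ ∣ x ∣
  -x≤∣x∣ x with abs-split x
  ... | inj₁ (eq , 0≤x) = ≤-trans (≤- 0≤x) (inj₂ (sym eq))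
  ... | inj₂ (eq , _)   = inj₂ (sym eq)

  ∣x∣≤ : ∀ {x y} → x ≤ y → - x ≤ y → ∣ x ∣ ≤ y
  ∣x∣≤ {x} x≤y -x≤y with abs-split x
  ... | inj₁ (eq , _) = ≤-trans (inj₂ eq) x≤y
  ... | inj₂ (eq , _) = ≤-trans (inj₂ eq) -x≤y

  ∣x∣≈x : ∀ {x} → 0# ≤ x → ∣ x ∣ ≈ x
  ∣x∣≈x {x} 0≤x = ≤-antisym (∣x∣≤ ≤-refl (≤- 0≤x)) (x≤∣x∣ x)

  0≤∣x∣ : ∀ x → 0# ≤ ∣ x ∣
  0≤∣x∣ x with abs-split x
  ... | inj₁ (eq , 0≤x) = ≤-trans 0≤x (inj₂ (sym eq))
  ... | inj₂ (eq , x<0) = ≤-trans (inj₁ (0<0-- x<0)) (inj₂ (sym eq))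

  ∣∣-swap : ∀ x y → ∣ x - y ∣ ≈ ∣ y - x ∣
  ∣∣-swap x y = ≤-antisym (half x y) (half y x)
    where
    half : ∀ x y → ∣ x - y ∣ ≤ ∣ y - x ∣
    half x y = ∣x∣≤
      (≤-trans (inj₂ (solve 2 (λ x y → x :- y := :- (y :- x)) refl x y)) (-x≤∣x∣ (y - x)))
      (≤-trans (inj₂ (solve 2 (λ x y → :- (x :- y) := y :- x) refl x y)) (x≤∣x∣ (y - x)))

  ∣∣-triangle : ∀ x y z → ∣ x - z ∣ ≤ ∣ x - y ∣ + ∣ y - z ∣
  ∣∣-triangle x y z = ∣x∣≤
    (by-≤ (x≤∣x∣ (x - y) ≤+≤ x≤∣x∣ (y - z))
      (solve 5 (λ x y z a b → (a :+ b) :- ((x :- y) :+ (y :- z)) := (a :+ b) :- (x :- z))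
        refl x y z _ _))
    (by-≤ (-x≤∣x∣ (x - y) ≤+≤ -x≤∣x∣ (y - z))
      (solve 5 (λ x y z a b → (a :+ b) :- (:- (x :- y) :+ :- (y :- z)) := (a :+ b) :- :- (x :- z))
        refl x y z _ _))

  sum-nonneg : ∀ {n} {f : Vector Carrier n} → NonNegative f → 0# ≤ sum f
  sum-nonneg {zero}  0≤f = ≤-refl
  sum-nonneg {suc n} 0≤f = 0≤-+ (0≤f zero) (sum-nonneg (0≤f ∘ suc))

  nonneg-sum≤0⇒0 : ∀ {n} {f : Vector Carrier n} → NonNegative f → sum f ≤ 0# → IsZero f
  nonneg-sum≤0⇒0 {suc n} {f} 0≤f Σ≤0 i = go i
    where
    head≤0 : f zero ≤ 0#
    head≤0 = by-≤ (Σ≤0 ≤+≤ sum-nonneg (0≤f ∘ suc)) (solve 2 (λ a b →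
      (con (+ 0) :+ b) :- ((a :+ b) :+ con (+ 0)) := con (+ 0) :- a) refl _ _)
    tail≤0 : sum (f ∘ suc) ≤ 0#
    tail≤0 = by-≤ (Σ≤0 ≤+≤ 0≤f zero) (solve 2 (λ a b →
      (con (+ 0) :+ a) :- ((a :+ b) :+ con (+ 0)) := con (+ 0) :- b) refl _ _)
    go : IsZero f
    go zero    = ≤-antisym head≤0 (0≤f zero)
    go (suc i) = nonneg-sum≤0⇒0 (0≤f ∘ suc) tail≤0 i

  upper-bound : ∀ {n} (f : Vector Carrier n) → ∃ λ c → ∀ i → f i < c
  upper-bound {zero}  f = 0# , λ ()
  upper-bound {suc n} f with upper-bound (f ∘ suc)
  ... | c , f<c with f zero <? c
  ... | yes f₀<c = c , λ { zero → f₀<c ; (suc i) → f<c i }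
  ... | no  f₀≮c = f zero + 1# , λ
    { zero    → above (f zero)
    ; (suc i) → <-trans (<-≤-trans (f<c i) (≮⇒≥ f₀≮c)) (above (f zero)) }

-- Fourier–Motzkin elimination.
module Alternative (ℝ : RealNumbers) where

  open RealNumbers ℝ hiding (zero)
  open OrderedField ℝ
  open Definitions ℝ using (sum-lin)
  open import Algebra.Properties.Semiring.Sum semiring

  infix 7 _·_
  _·_ : ∀ {n} → Vector Carrier n → Vector Carrier n → Carrier
  v · x = sum λ c → v c * x c

  ·-combine : ∀ {n} a b (u v x : Vector Carrier n) →
              (λ c → a * u c + b * v c) · x ≈ a * (u · x) + b * (v · x)
  ·-combine {n} a b u v x = trans (sum-cong-≋ {n} λ c →
      solve 5 (λ a b u v x → (a :* u :+ b :* v) :* x := a :* (u :* x) :+ b :* (v :* x))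
        refl a b (u c) (v c) (x c))
    (trans (sum-lin {n} b _ _) (+-congʳ (sym (*-distribˡ-sum {n} a _))))

  Positive : ∀ {n} → List (Vector Carrier n) → Vector Carrier n → Set
  Positive vs x = ∀ {v} → v ∈ vs → 0# < v · x

  -- The combinations with nonnegative coefficients that are not all zero.
  data Cone {n} (vs : List (Vector Carrier n)) : Vector Carrier n → Set where
    gen     : ∀ {v} → v ∈ vs → Cone vs v
    combine : ∀ {a b u v} → 0# < a → 0# < b → Cone vs u → Cone vs v →
              Cone vs (λ c → a * u c + b * v c)
    resp    : ∀ {u v} → (∀ c → u c ≈ v c) → Cone vs u → Cone vs v

  upper : (as : List Carrier) → ∃ λ s → (∀ {a} → a ∈ as → a < s)
  upper []       = 0# , λ ()
  upper (a ∷ as) with upper as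
  ... | s , as<s with a <? s
  ... | yes a<s = s , λ { (here ≡.refl) → a<s ; (there a∈) → as<s a∈ }
  ... | no  a≮s = a + 1# , λ { (here ≡.refl) → above a
                             ; (there a∈) → <-trans (<-≤-trans (as<s a∈) (≮⇒≥ a≮s)) (above a) }

  squeeze : ∀ a (bs : List Carrier) → (∀ {b} → b ∈ bs → a < b) →
            ∃ λ t → a < t × (∀ {b} → b ∈ bs → t < b)
  squeeze a []       _    = a + 1# , above a , λ ()
  squeeze a (b ∷ bs) a<bs with squeeze a bs (a<bs ∘ there)
  ... | t , a<t , t<bs with t <? b
  ... | yes t<b = t , a<t , λ { (here ≡.refl) → t<b ; (there b∈) → t<bs b∈ }
  ... | no  t≮b = let t′ , a<t′ , t′<b = dense (a<bs (here ≡.refl)) in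
        t′ , a<t′ , λ
        { (here ≡.refl) → t′<b
        ; (there b∈)    → <-trans (<-≤-trans t′<b (≮⇒≥ t≮b)) (t<bs b∈) }

  -- Supplies the value of the eliminated variable. Either list may be empty, so there need not be a
  -- largest lower or a smallest upper bound to average; density is invoked only when an earlier
  -- choice violates a new bound.
  separate : (as bs : List Carrier) → (∀ {a b} → a ∈ as → b ∈ bs → a < b) →
             ∃ λ t → (∀ {a} → a ∈ as → a < t) × (∀ {b} → b ∈ bs → t < b)
  separate []       bs as<bs with upper (map -_ bs)
  ... | s , -bs<s = - s , (λ ()) , λ b∈ → by-< (-bs<s (∈-map⁺ -_ b∈))
        (solve 2 (λ s b → s :- :- b := b :- :- s) refl s _)
  separate (a ∷ as) bs as<bs with separate as bs (as<bs ∘ there)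
  ... | t , as<t , t<bs with a <? t
  ... | yes a<t = t , (λ { (here ≡.refl) → a<t ; (there a∈) → as<t a∈ }) , t<bs
  ... | no  a≮t = proj₁ found , (λ { (here ≡.refl) → proj₁ (proj₂ found)
                                   ; (there a∈) →
                                       <-trans (<-≤-trans (as<t a∈) (≮⇒≥ a≮t)) (proj₁ (proj₂ found)) }) ,
                  proj₂ (proj₂ found)
    where
    found = squeeze a bs (as<bs (here ≡.refl))

  module _ {n} (vs : List (Vector Carrier (suc n))) where

    zeros poss negs : List (Vector Carrier (suc n))
    zeros = filter (λ v → v zero ≟ 0#) vs
    poss  = filter (λ v → 0# <? v zero) vs
    negs  = filter (λ v → v zero <? 0#) vs

    -- For `p` in `poss` and `q` in `negs` both multipliers are positive. They cancel the first
    -- coordinates without division, and the result stays in the cone of the old rows.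
    eliminate : Vector Carrier (suc n) → Vector Carrier (suc n) → Vector Carrier n
    eliminate p q c = - q zero * p (suc c) + p zero * q (suc c)

    eliminated : List (Vector Carrier n)
    eliminated = map (_∘ suc) zeros List.++ cartesianProductWith eliminate poss negs

    -- Each eliminated row is a cone combination of old rows with first coordinate zero, so a
    -- refutation of the smaller system refutes the larger one.
    lift-cone : ∀ {w} → Cone eliminated w → Cone vs (0# Vector.∷ w)
    lift-cone (gen v∈) with ∈-++⁻ (map (_∘ suc) zeros) v∈
    ... | inj₁ v∈z with ∈-map⁻ (_∘ suc) v∈z
    ... | v , v∈ , ≡.refl with ∈-filter⁻ (λ v → v zero ≟ 0#) {xs = vs} v∈
    ... | v∈vs , v₀≈0 = resp (λ { zero → v₀≈0 ; (suc c) → refl }) (gen v∈vs)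
    lift-cone (gen v∈) | inj₂ v∈pq with ∈-cartesianProductWith⁻ eliminate poss negs v∈pq
    ... | p , q , p∈ , q∈ , ≡.refl
      with ∈-filter⁻ (λ v → 0# <? v zero) {xs = vs} p∈ | ∈-filter⁻ (λ v → v zero <? 0#) {xs = vs} q∈
    ... | p∈vs , 0<p₀ | q∈vs , q₀<0 = resp
      (λ { zero    → solve 2 (λ p q → (:- q) :* p :+ p :* q := con (+ 0)) refl _ _
         ; (suc c) → refl })
      (combine (0<0-- q₀<0) 0<p₀ (gen p∈vs) (gen q∈vs))
    lift-cone (combine {a} {b} 0<a 0<b u v) = resp
      (λ { zero    → solve 2 (λ a b → a :* con (+ 0) :+ b :* con (+ 0) := con (+ 0)) refl a b
         ; (suc c) → refl })
      (combine 0<a 0<b (lift-cone u) (lift-cone v))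
    lift-cone (resp eq u) = resp (λ { zero → refl ; (suc c) → eq c }) (lift-cone u)

    module _ (x : Vector Carrier n) (x-pos : Positive eliminated x) where

      -- The value of the first variable at which v vanishes; junk if v zero ≈ 0#.
      root : Vector Carrier (suc n) → Carrier
      root v with v zero ≟ 0#
      ... | yes _   = 0#
      ... | no  v≉0 = - (proj₁ (inverse (v zero) v≉0) * ((v ∘ suc) · x))

      -- The right side is the value of `v` at the vector with head `t` and tail `x`. In factored
      -- form its positivity makes `root v` a lower bound for `t` if `v zero` is positive and an
      -- upper bound if it is negative.
      root-spec : ∀ v → ¬ v zero ≈ 0# → ∀ t →
                  v zero * (t - root v) ≈ v zero * t + (v ∘ suc) · x
      root-spec v v≉0′ t with v zero ≟ 0#
      ... | yes v≈0 = ⊥-elim (v≉0′ v≈0)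
      ... | no  v≉0 = trans
        (solve 4 (λ v t i d → v :* (t :- :- (i :* d)) := v :* t :+ (v :* i) :* d) refl _ t _ _)
        (+-congˡ (trans (*-congʳ (proj₂ (inverse (v zero) v≉0))) (*-identityˡ _)))

      -- Up to the positive factor `p zero * - q zero`, the difference of the roots is the value of
      -- the eliminated row at `x`.
      roots : ∀ {p q} → p ∈ poss → q ∈ negs → root p < root q
      roots {p} {q} p∈ q∈ = by-< (*-cancel-pos (*-pos 0<p₀ (0<0-- q₀<0)) (<-respʳ-≈ eq 0<e))
        (solve 2 (λ a b → (b :- a) :- con (+ 0) := b :- a) refl _ _)
        where
        0<p₀ = proj₂ (∈-filter⁻ (λ v → 0# <? v zero) {xs = vs} p∈)
        q₀<0 = proj₂ (∈-filter⁻ (λ v → v zero <? 0#) {xs = vs} q∈)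
        p≉0 : ¬ p zero ≈ 0#
        p≉0 eq = irrefl (sym eq) 0<p₀
        q≉0 : ¬ q zero ≈ 0#
        q≉0 eq = irrefl eq q₀<0
        0<e : 0# < eliminate p q · x
        0<e = x-pos (∈-++⁺ʳ (map (_∘ suc) zeros) (∈-cartesianProductWith⁺ eliminate p∈ q∈))
        eq : eliminate p q · x ≈ (p zero * - q zero) * (root q - root p)
        eq = trans (·-combine _ _ (p ∘ suc) (q ∘ suc) x)
          (trans (solve 4 (λ p q d e → (:- q) :* d :+ p :* e :=
                   (:- q) :* (p :* con (+ 0) :+ d) :+ p :* (q :* con (+ 0) :+ e)) refl _ _ _ _)
          (trans (+-cong (*-congˡ (sym (root-spec p p≉0 0#))) (*-congˡ (sym (root-spec q q≉0 0#))))
          (solve 4 (λ p q r s → (:- q) :* (p :* (con (+ 0) :- r)) :+ p :* (q :* (con (+ 0) :- s)) :=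
            (p :* (:- q)) :* (s :- r)) refl (p zero) (q zero) (root p) (root q))))

      separated : ∀ {a b} → a ∈ map root poss → b ∈ map root negs → a < b
      separated a∈ b∈ with ∈-map⁻ root a∈ | ∈-map⁻ root b∈
      ... | _ , p∈ , ≡.refl | _ , q∈ , ≡.refl = roots p∈ q∈

      lift-solution : ∃ (Positive vs)
      lift-solution with separate (map root poss) (map root negs) separated
      ... | t , <t , t< = t Vector.∷ x , pos
        where
        pos : Positive vs (t Vector.∷ x)
        pos {v} v∈ with compare 0# (v zero)
        ... | tri< 0<v _ _ = <-respʳ-≈ (root-spec v (λ eq → irrefl (sym eq) 0<v) t)
              (*-pos 0<v (<⇒0<- (<t (∈-map⁺ root (∈-filter⁺ (λ v → 0# <? v zero) v∈ 0<v)))))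
        ... | tri> _ _ v<0 = <-respʳ-≈ (trans
              (solve 3 (λ v t r → (:- v) :* (r :- t) := v :* (t :- r)) refl (v zero) t (root v))
              (root-spec v (λ eq → irrefl eq v<0) t))
              (*-pos (0<0-- v<0) (<⇒0<- (t< (∈-map⁺ root (∈-filter⁺ (λ v → v zero <? 0#) v∈ v<0)))))
        ... | tri≈ _ 0≈v _ = <-respʳ-≈
              (sym (trans (+-congʳ (trans (*-congʳ (sym 0≈v)) (zeroˡ t))) (+-identityˡ _)))
              (x-pos (∈-++⁺ˡ (∈-map⁺ (_∘ suc) (∈-filter⁺ (λ v → v zero ≟ 0#) v∈ (sym 0≈v)))))

  gordan : ∀ {n} (vs : List (Vector Carrier n)) → ∃ (Positive vs) ⊎ Cone vs (λ _ → 0#)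
  gordan {zero}  []       = inj₁ ((λ ()) , λ ())
  -- In dimension zero every value is an empty sum, so no row can be positive, and any row is
  -- already the zero vector.
  gordan {zero}  (v ∷ vs) = inj₂ (resp (λ ()) (gen (here ≡.refl)))
  gordan {suc n} vs with gordan (eliminated vs)
  ... | inj₁ (x , x-pos) = inj₁ (lift-solution vs x x-pos)
  ... | inj₂ cone        = inj₂ (resp (λ { zero → refl ; (suc c) → refl }) (lift-cone vs cone))

-- Simple paths extracted from walks.

module SimplePaths {n} (T : Rel (Fin n) 0ℓ) where

  -- In the format of `IsCycle`: an edge from the last vertex back to the first closes a path with
  -- at least three vertices to a cycle.
  SimplePath : Rel (Fin n) 0ℓ
  SimplePath u v = ∃ λ k → Σ (Fin (suc k) → Fin n) λ c →
    Injective _≡_ _≡_ c × (∀ i → T (c (inject₁ i)) (c (suc i))) ×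
    c zero ≡ u × c (fromℕ k) ≡ v

  suffix : ∀ {u v} (P : SimplePath u v) i → SimplePath (proj₁ (proj₂ P) i) v
  suffix (k , c , inj , steps , _ , last) zero = k , c , inj , steps , ≡.refl , last
  suffix (suc k , c , inj , steps , _ , last) (suc i) =
    suffix (k , c ∘ suc , Finₚ.suc-injective ∘ inj , steps ∘ suc , ≡.refl , last) i

  erase-loops : ∀ {u v} → Star T u v → SimplePath u v
  erase-loops {u} ε =
    0 , (λ _ → u) , (λ { {zero} {zero} _ → ≡.refl }) , (λ ()) , ≡.refl , ≡.refl
  erase-loops {u} (_◅_ {j = w} Tuw walk) with erase-loops walk
  ... | P@(k , c , inj , steps , first , last) with Finₚ.any? (λ i → c i Finₚ.≟ u)
  -- The simple path revisits `u` at position `i`; everything before this visit is a loop and is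
  -- dropped.
  ... | yes (i , ≡.refl) = suffix P i
  ... | no  u∉c = suc k , u Vector.∷ c , inj′ ,
                  (λ { zero → ≡.subst (T u) (≡.sym first) Tuw ; (suc i) → steps i }) ,
                  ≡.refl , last
    where
    inj′ : Injective _≡_ _≡_ (u Vector.∷ c)
    inj′ {zero}  {zero}  _  = ≡.refl
    inj′ {zero}  {suc j} eq = ⊥-elim (u∉c (j , ≡.sym eq))
    inj′ {suc i} {zero}  eq = ⊥-elim (u∉c (i , eq))
    inj′ {suc i} {suc j} eq = ≡.cong suc (inj eq)

-- Path metrics of weighted trees and the four-point equality.

module TreeMetric (ℝ : RealNumbers) (W : Definitions.WeightedGraph ℝ) where

  open RealNumbers ℝ hiding (zero)
  open OrderedField ℝ
  open Definitions ℝ using (module WeightedGraph; SameUnorderedPair)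
  open WeightedGraph W

  walkLength-◅◅ : ∀ {u v w} (p : Star Adj u v) (q : Star Adj v w) →
                  walkLength (p ◅◅ q) ≈ walkLength p + walkLength q
  walkLength-◅◅ ε       q = sym (+-identityˡ _)
  walkLength-◅◅ (_ ◅ p) q = trans (+-congˡ (walkLength-◅◅ p q)) (sym (+-assoc _ _ _))

  walkLength-nonneg : ∀ {u v} (p : Star Adj u v) → 0# ≤ walkLength p
  walkLength-nonneg ε        = ≤-refl
  walkLength-nonneg (uv ◅ p) = 0≤-+ (inj₁ (edgeLength-pos uv)) (walkLength-nonneg p)

  walkLength-reverse : ∀ {u v} (p : Star Adj u v) →
                       ∃ λ (q : Star Adj v u) → walkLength q ≈ walkLength p
  walkLength-reverse ε        = ε , refl
  walkLength-reverse (uv ◅ p) with walkLength-reverse p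
  ... | q , eq = q ◅◅ (adj-sym uv ◅ ε) , trans (walkLength-◅◅ q _)
    (trans (+-cong eq (trans (+-identityʳ _) (edgeLength-sym (adj-sym uv)))) (+-comm _ _))

  module _ (acyclic : ∀ {k} (c : Fin (suc k) → V) → ¬ IsCycle c)
           (dist : V → V → Carrier) (isPathMetric : IsPathMetric dist) where

    private
      geodesic = proj₁ isPathMetric
      minimal  = proj₂ isPathMetric

    Avoiding : V → V → Rel V 0ℓ
    Avoiding a b u v = Adj u v × ¬ SameUnorderedPair u v a b

    -- The deleted edge would close a simple path from `b` to `a` to a cycle. Paths with one or two
    -- vertices need reasons of their own: the first makes `a` equal to `b`, the second is the
    -- deleted edge itself.
    bridge : ∀ {a b} → Adj a b → ¬ Star (Avoiding a b) b a
    bridge {a} {b} ab walk with SimplePaths.erase-loops (Avoiding a b) walk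
    ... | 0 , c , _ , _ , ≡.refl , eq = adj-irrefl (≡.sym eq) ab
    ... | 1 , c , _ , steps , ≡.refl , ≡.refl = proj₂ (steps zero) (inj₂ (≡.refl , ≡.refl))
    ... | suc (suc k) , c , inj , steps , ≡.refl , ≡.refl =
      acyclic c (ℕ.s≤s (ℕ.s≤s ℕ.z≤n) , inj , proj₁ ∘ steps , ab)

    Avoiding-sym : ∀ {a b u v} → Avoiding a b u v → Avoiding a b v u
    Avoiding-sym (uv , ¬same) = adj-sym uv , λ
      { (inj₁ (p , q)) → ¬same (inj₂ (q , p)) ; (inj₂ (p , q)) → ¬same (inj₁ (q , p)) }

    dist-nonneg : ∀ u v → 0# ≤ dist u v
    dist-nonneg u v with geodesic u v
    ... | p , eq = ≤-trans (walkLength-nonneg p) (inj₂ (sym eq))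

    dist-refl : ∀ u → dist u u ≈ 0#
    dist-refl u = ≤-antisym (minimal ε) (dist-nonneg u u)

    dist-sym : ∀ u v → dist u v ≈ dist v u
    dist-sym u v = ≤-antisym (half u v) (half v u)
      where
      half : ∀ u v → dist u v ≤ dist v u
      half u v with geodesic v u
      ... | p , eq with walkLength-reverse p
      ... | q , eq′ = ≤-trans (minimal q) (inj₂ (trans eq′ (sym eq)))

    triangle : ∀ u v w → dist u w ≤ dist u v + dist v w
    triangle u v w with geodesic u v | geodesic v w
    ... | p , p≈ | q , q≈ = ≤-trans (minimal (p ◅◅ q))
      (inj₂ (trans (walkLength-◅◅ p q) (sym (+-cong p≈ q≈))))

    dist-edge : ∀ {a b} → Adj a b → dist a b ≤ edgeLength a b
    dist-edge ab = ≤-trans (minimal (ab ◅ ε)) (inj₂ (+-identityʳ _))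

    dist-step : ∀ {u w} x → Adj u w → dist u x ≤ edgeLength u w + dist w x
    dist-step {u} {w} x uw = ≤-trans (triangle u w x) (dist-edge uw ≤+≤ ≤-refl)

    module _ {a b : V} (ab : Adj a b) where

      private
        ℓ : Carrier
        ℓ = edgeLength a b
        0<ℓ : 0# < ℓ
        0<ℓ = edgeLength-pos ab
        d = dist

      -- At the first use of the edge the rest of the walk is merely bounded below by a distance;
      -- the steps before it are absorbed by the triangle inequality.
      walk-crossing : ∀ {u v} (p : Star Adj u v) → Star (Avoiding a b) u v ⊎
                      (d u a + ℓ + d b v ≤ walkLength p ⊎ d u b + ℓ + d a v ≤ walkLength p)
      walk-crossing ε = inj₁ ε
      walk-crossing {u} {v} (_◅_ {j = w} uw p)
        with (u Finₚ.≟ a ×-dec w Finₚ.≟ b) ⊎-dec (u Finₚ.≟ b ×-dec w Finₚ.≟ a)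
      ... | yes (inj₁ (≡.refl , ≡.refl)) = inj₂ (inj₁ (by-≤ (minimal p)
        (trans (solve 3 (λ d p e → p :- d := (e :+ p) :- (con (+ 0) :+ e :+ d)) refl _ _ _)
          (+-congˡ (-‿cong (+-congʳ (+-congʳ (sym (dist-refl a)))))))))
      ... | yes (inj₂ (≡.refl , ≡.refl)) = inj₂ (inj₂ (by-≤ (minimal p)
        (trans (solve 3 (λ d p e → p :- d := (e :+ p) :- (con (+ 0) :+ e :+ d)) refl _ _ _)
          (+-cong (+-congʳ (edgeLength-sym ab)) (-‿cong (+-congʳ (+-congʳ (sym (dist-refl b)))))))))
      ... | no ¬same with walk-crossing p
      ... | inj₁ avoiding = inj₁ ((uw , ¬same) ◅ avoiding)
      ... | inj₂ (inj₁ le) = inj₂ (inj₁ (by-≤ (dist-step a uw ≤+≤ le) (solve 6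
        (λ e t s l y p → (e :+ t :+ p) :- (s :+ (t :+ l :+ y)) := (e :+ p) :- (s :+ l :+ y))
        refl _ _ _ _ _ _)))
      ... | inj₂ (inj₂ le) = inj₂ (inj₂ (by-≤ (dist-step b uw ≤+≤ le) (solve 6
        (λ e t s l y p → (e :+ t :+ p) :- (s :+ (t :+ l :+ y)) := (e :+ p) :- (s :+ l :+ y))
        refl _ _ _ _ _ _)))

      crossing : ∀ u v → Star (Avoiding a b) u v ⊎
                 (d u a + ℓ + d b v ≤ d u v ⊎ d u b + ℓ + d a v ≤ d u v)
      crossing u v with geodesic u v
      ... | p , eq with walk-crossing p
      ... | inj₁ avoiding  = inj₁ avoiding
      ... | inj₂ (inj₁ le) = inj₂ (inj₁ (≤-trans le (inj₂ (sym eq))))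
      ... | inj₂ (inj₂ le) = inj₂ (inj₂ (≤-trans le (inj₂ (sym eq))))

      -- The two sides of the tree cut at the edge, told apart by distances instead of connectivity.
      -- The reverse inequalities follow from the triangle inequality and the length of the edge.
      Near Far : V → Set
      Near u = d u a + ℓ ≤ d u b
      Far  u = d u b + ℓ ≤ d u a

      near⇒¬far : ∀ u → Near u → ¬ Far u
      near⇒¬far u near far = <⇒≱ (0<-+ 0<ℓ 0<ℓ) (by-≤ (near ≤+≤ far)
        (solve 3 (λ x y l → (y :+ x) :- ((x :+ l) :+ (y :+ l)) := con (+ 0) :- (l :+ l))
          refl _ _ _))

      walk-to-a : ∀ u → Star (Avoiding a b) u a ⊎ Far u
      walk-to-a u with crossing u a
      ... | inj₁ avoiding  = inj₁ avoiding
      ... | inj₂ (inj₁ le) = ⊥-elim (<⇒≱ 0<ℓ (by-≤ (dist-nonneg b a ≤+≤ le)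
        (solve 3 (λ x y l → (y :+ x) :- (con (+ 0) :+ (x :+ l :+ y)) := con (+ 0) :- l)
          refl _ _ _)))
      ... | inj₂ (inj₂ le) = inj₂ (by-≤ (dist-nonneg a a ≤+≤ le)
        (solve 4 (λ x y z l → (z :+ x) :- (con (+ 0) :+ (y :+ l :+ z)) := x :- (y :+ l))
          refl _ _ _ _))

      walk-to-b : ∀ u → Star (Avoiding a b) u b ⊎ Near u
      walk-to-b u with crossing u b
      ... | inj₁ avoiding  = inj₁ avoiding
      ... | inj₂ (inj₂ le) = ⊥-elim (<⇒≱ 0<ℓ (by-≤ (dist-nonneg a b ≤+≤ le)
        (solve 3 (λ x y l → (y :+ x) :- (con (+ 0) :+ (x :+ l :+ y)) := con (+ 0) :- l)
          refl _ _ _)))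
      ... | inj₂ (inj₁ le) = inj₂ (by-≤ (dist-nonneg b b ≤+≤ le)
        (solve 4 (λ x y z l → (z :+ x) :- (con (+ 0) :+ (y :+ l :+ z)) := x :- (y :+ l))
          refl _ _ _ _))

      -- Otherwise there would be walks from `u` to both ends avoiding the edge, and together they
      -- would join the ends without it, against `bridge`.
      near⊎far : ∀ u → Near u ⊎ Far u
      near⊎far u with walk-to-a u | walk-to-b u
      ... | inj₂ far | _         = inj₂ far
      ... | _        | inj₂ near = inj₁ near
      ... | inj₁ ua  | inj₁ ub   = ⊥-elim (bridge ab (Star.reverse Avoiding-sym ub ◅◅ ua))

      separation : ∀ {u v} → Near u → Far v → d u v ≈ d u a + ℓ + d b v
      separation {u} {v} near far = ≤-antisym upper lower
        where
        upper : d u v ≤ d u a + ℓ + d b v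
        upper = by-≤ (triangle u a v ≤+≤ dist-step v ab) (solve 5
          (λ uv ua av l bv → (ua :+ av :+ (l :+ bv)) :- (uv :+ av) := (ua :+ l :+ bv) :- uv)
          refl _ _ _ _ _)
        lower : d u a + ℓ + d b v ≤ d u v
        lower with crossing u v
        ... | inj₂ (inj₁ le) = le
        -- With `u` on the side of `a` and `v` on the side of `b`, a crossing from `b` to `a` is
        -- longer than required by at least two edge lengths.
        ... | inj₂ (inj₂ le) = by-≤ (le ≤+≤ near ≤+≤ far ≤+≤ (inj₁ (0<-+ 0<ℓ 0<ℓ))
            ≤+≤ inj₂ (dist-sym b v) ≤+≤ inj₂ (dist-sym v a))
          (solve 8 (λ ua ub va vb av bv l uv →
            (uv :+ ub :+ va :+ (l :+ l) :+ vb :+ av) :- (ub :+ l :+ av :+ (ua :+ l) :+ (vb :+ l)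
                :+ con (+ 0) :+ bv :+ va) := uv :- (ua :+ l :+ bv)) refl _ _ _ _ _ _ _ _)
        ... | inj₁ uv with walk-to-a u | walk-to-b v
        ... | inj₂ far′ | _          = ⊥-elim (near⇒¬far u near far′)
        ... | _         | inj₂ near′ = ⊥-elim (near⇒¬far v near′ far)
        ... | inj₁ ua   | inj₁ vb    = ⊥-elim (bridge ab
              (Star.reverse Avoiding-sym (uv ◅◅ vb) ◅◅ ua))

    -- If no step went up, the potential could not go up from end to end. The length bound records
    -- that the edge lies on the walk; for a geodesic it determines on which side each end lies.
    increase : ∀ (φ : V → Carrier) {u v} (p : Star Adj u v) → φ u < φ v →
               ∃ λ a → ∃ λ b → Σ (Adj a b) λ _ → φ a < φ b ×
               dist u a + edgeLength a b + dist b v ≤ walkLength p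
    increase φ ε φu<φu = ⊥-elim (irrefl refl φu<φu)
    increase φ {u} {v} (_◅_ {j = w} uw p) φu<φv with φ u <? φ w
    ... | yes φu<φw = u , w , uw , φu<φw , by-≤ (minimal p ≤+≤ inj₂ (dist-refl u))
      (solve 4 (λ x e d p → (p :+ con (+ 0)) :- (d :+ x) := (e :+ p) :- (x :+ e :+ d)) refl _ _ _ _)
    ... | no  φu≮φw with increase φ p (≤-<-trans (≮⇒≥ φu≮φw) φu<φv)
    ... | a , b , ab , φa<φb , le = a , b , ab , φa<φb , by-≤ (dist-step a uw ≤+≤ le) (solve 6
        (λ e t s l y p → (e :+ t :+ p) :- (s :+ (t :+ l :+ y)) := (e :+ p) :- (s :+ l :+ y))
        refl _ _ _ _ _ _)

    -- Some edge of the geodesic from i to j separates {x, i} from {y, j}.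
    four-point : ∀ {x i j y} → dist x i + dist j y < dist x j + dist i y →
                 dist x j + dist i y ≈ dist x y + dist i j
    four-point {x} {i} {j} {y} lt
      with increase (λ v → dist x v - dist v y) (proj₁ (geodesic i j))
             (by-< lt (solve 4 (λ xi jy xj iy → (xj :+ iy) :- (xi :+ jy) :=
               (xj :- jy) :- (xi :- iy)) refl _ _ _ _))
    ... | a , b , ab , φa<φb , le = trans
        (+-cong (separation ab near-x far-j) (separation ab near-i far-y))
        (trans (solve 5 (λ xa l bj ia by → (xa :+ l :+ bj) :+ (ia :+ l :+ by) :=
                                          (xa :+ l :+ by) :+ (ia :+ l :+ bj)) refl _ _ _ _ _)
          (sym (+-cong (separation ab near-x far-y) (separation ab near-i far-j))))
      where
      le′ : dist i a + edgeLength a b + dist b j ≤ dist i j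
      le′ = ≤-trans le (inj₂ (sym (proj₂ (geodesic i j))))
      near-i : Near ab i
      near-i = by-≤ (le′ ≤+≤ triangle i b j) (solve 5
        (λ ia l bj ij ib → (ij :+ (ib :+ bj)) :- (ia :+ l :+ bj :+ ij) := ib :- (ia :+ l))
          refl _ _ _ _ _)
      far-j : Far ab j
      far-j = by-≤ (le′ ≤+≤ triangle i a j ≤+≤ inj₂ (dist-sym a j) ≤+≤ inj₂ (dist-sym j b)) (solve 7
        (λ ia l bj ij aj ja jb → (ij :+ (ia :+ aj) :+ ja :+ bj) :-
          (ia :+ l :+ bj :+ ij :+ aj :+ jb) := ja :- (jb :+ l))
        refl _ _ _ _ _ _ _)
      near-x : Near ab x
      near-x with near⊎far ab x
      ... | inj₁ near = near
      -- If `x` were on the far side, going from `a` to `b` would lower the distance to `x` by a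
      -- full edge length and the distance to `y` by at most as much, so the potential could not
      -- increase.
      ... | inj₂ far  = ⊥-elim (absurd-< (φa<φb <+≤ far <+≤ dist-step y ab) (solve 5
        (λ xa ay xb by l → ((xb :- by) :+ xa :+ (l :+ by)) :- ((xa :- ay) :+ (xb :+ l) :+ ay) :=
          con (+ 0))
        refl _ _ _ _ _))
      far-y : Far ab y
      far-y with near⊎far ab y
      ... | inj₂ far  = far
      ... | inj₁ near = ⊥-elim (absurd-< (φa<φb <+≤ near <+≤ triangle x a b <+≤ dist-edge ab
          <+≤ inj₂ (dist-sym a y) <+≤ inj₂ (dist-sym y b)) (solve 8
        (λ xa ay xb by l ya yb ab → ((xb :- by) :+ yb :+ (xa :+ ab) :+ l :+ ya :+ by) :-
          ((xa :- ay) :+ (ya :+ l) :+ xb :+ ab :+ ay :+ yb) := con (+ 0)) refl _ _ _ _ _ _ _ _))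

-- Acyclicity of graphs with a parent relation.

argmax : ∀ {k} (f : Fin (suc k) → ℕ) → ∃ λ i → ∀ j → f j ℕ.≤ f i
argmax {zero}  f = zero , λ { zero → ℕₚ.≤-refl }
argmax {suc k} f with argmax (f ∘ suc)
... | i , max with f (suc i) ℕₚ.≤? f zero
... | yes le = zero , λ { zero → ℕₚ.≤-refl ; (suc j) → ℕₚ.≤-trans (max j) le }
... | no  gt = suc i , λ { zero → ℕₚ.<⇒≤ (ℕₚ.≰⇒> gt) ; (suc j) → max j }

module _ (G : Graph) where
  open Graph G

  -- The two neighbours are the predecessor and the successor in cyclic order. They differ because a
  -- cycle has at least three vertices; the closing edge serves the first and the last vertex.
  cycle-neighbours : ∀ {k} (c : Fin (suc k) → V) → IsCycle c → ∀ i →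
                     ∃ λ j → ∃ λ j′ → j ≢ j′ × Adj (c i) (c j) × Adj (c i) (c j′)
  cycle-neighbours {suc zero} c (ℕ.s≤s () , _) zero
  cycle-neighbours {suc (suc k)} c (_ , _ , steps , close) zero =
    suc zero , fromℕ (suc (suc k)) , (λ ()) , steps zero , adj-sym close
  cycle-neighbours {k} c (2≤k , _ , steps , close) (suc i) with k ℕₚ.≟ toℕ (suc i)
  ... | yes k≡ = inject₁ i , zero , i≢0 , adj-sym (steps i) ,
                 ≡.subst (λ j → Adj (c j) (c zero)) last close
    where
    last : fromℕ k ≡ suc i
    last = Finₚ.toℕ-injective (≡.trans (Finₚ.toℕ-fromℕ k) k≡)
    i≢0 : inject₁ i ≢ zero
    i≢0 eq = ℕₚ.<-irrefl (≡.sym (≡.trans k≡ (≡.cong suc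
      (≡.trans (≡.sym (Finₚ.toℕ-inject₁ i)) (≡.cong toℕ eq))))) 2≤k
  ... | no  k≢ = inject₁ i , suc (Fin.lower₁ (suc i) k≢) , i≢ , adj-sym (steps i) ,
                 ≡.subst (λ j → Adj (c j) (c (suc (Fin.lower₁ (suc i) k≢))))
                   (Finₚ.inject₁-lower₁ (suc i) k≢)
                   (steps (Fin.lower₁ (suc i) k≢))
    where
    i≢ : inject₁ i ≢ suc (Fin.lower₁ (suc i) k≢)
    i≢ eq = ℕₚ.<-irrefl (≡.trans (≡.sym (Finₚ.toℕ-inject₁ i)) (≡.trans (≡.cong toℕ eq)
      (≡.cong suc (Finₚ.toℕ-lower₁ (suc i) k≢)))) (ℕₚ.m≤n⇒m≤1+n (ℕₚ.n<1+n (toℕ i)))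

  -- On a cycle both neighbours of a vertex of maximal rank would be its parent.
  rooted⇒acyclic : (Parent : Rel V 0ℓ) (rank : V → ℕ) →
                   (∀ {u v} → Adj u v → Parent u v ⊎ Parent v u) →
                   (∀ {u v} → Parent u v → rank v ℕ.< rank u) →
                   (∀ {u v w} → Parent u v → Parent u w → v ≡ w) →
                   ∀ {k} (c : Fin (suc k) → V) → ¬ IsCycle c
  rooted⇒acyclic Parent rank adj decreasing functional c cyc@(_ , inj , _)
    with argmax (rank ∘ c)
  ... | i , max with cycle-neighbours c cyc i
  ... | j , j′ , j≢j′ , ij , ij′ = j≢j′ (inj (functional (up ij) (up ij′)))
    where
    up : ∀ {j} → Adj (c i) (c j) → Parent (c i) (c j)
    up {j} ij with adj ij
    ... | inj₁ par = par
    ... | inj₂ par = ⊥-elim (ℕₚ.<⇒≱ (decreasing par) (max j))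

-- Finite sequences with increasing steps.

module _ (ℝ : RealNumbers) where
  open RealNumbers ℝ hiding (zero)
  open OrderedField ℝ

  strictly-increasing : ∀ {p} (f : Fin (suc p) → Carrier) →
    (∀ k → f (inject₁ k) < f (suc k)) → ∀ {i j} → i Fin.< j → f i < f j
  strictly-increasing {p} f step {i} {suc j} (ℕ.s≤s i≤j) = ≤-<-trans
    (<-weakInduction-startingFrom (λ j → f i ≤ f j) ≤-refl
      (λ k le → ≤-trans le (inj₁ (step k)))
      (≡.subst (toℕ i ℕ.≤_) (≡.sym (Finₚ.toℕ-inject₁ j)) i≤j))
    (step j)

  increasing : ∀ {p} (f : Fin (suc p) → Carrier) →
    (∀ k → f (inject₁ k) < f (suc k)) → ∀ {i j} → i Fin.≤ j → f i ≤ f j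
  increasing f step i≤j with ℕₚ.m≤n⇒m<n∨m≡n i≤j
  ... | inj₁ i<j = inj₁ (strictly-increasing f step i<j)
  ... | inj₂ i≡j = inj₂ (reflexive (≡.cong f (Finₚ.toℕ-injective i≡j)))

-- The i-th leaf hangs at distance leg i from the spine vertex at position at i.
module Caterpillars (ℝ : RealNumbers) {m : ℕ} (at leg : Fin (suc (suc m)) → RealNumbers.Carrier ℝ)
  (at-step : ∀ k → RealNumbers._<_ ℝ (at (inject₁ k)) (at (suc k)))
  (leg-pos : ∀ i → RealNumbers._<_ ℝ (RealNumbers.0# ℝ) (leg i)) where

  open RealNumbers ℝ hiding (zero)
  open OrderedField ℝ
  open Definitions ℝ using (WeightedGraph; module WeightedGraph; Caterpillar)

  private
    n : ℕ
    n = suc (suc m)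
    Vertex : Set
    Vertex = Fin (n ℕ.+ n)

  spine leaf : Fin n → Vertex
  spine i = i ↑ˡ n
  leaf  i = n ↑ʳ i

  place : Vertex → Fin n ⊎ Fin n
  place = splitAt n

  place-spine : ∀ (i : Fin n) → place (spine i) ≡ inj₁ i
  place-spine i = Finₚ.splitAt-↑ˡ n i n

  place-leaf : ∀ (i : Fin n) → place (leaf i) ≡ inj₂ i
  place-leaf i = Finₚ.splitAt-↑ʳ n n i

  place-injective : ∀ {u v} → place u ≡ place v → u ≡ v
  place-injective {u} {v} eq = ≡.trans (≡.sym (Finₚ.join-splitAt n n u))
    (≡.trans (≡.cong (Fin.join n n) eq) (Finₚ.join-splitAt n n v))

  -- The tree is rooted at `spine zero`, and `rank` is the depth below this root.
  Parent : Rel (Fin n ⊎ Fin n) 0ℓ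
  Parent (inj₁ i) (inj₁ j) = toℕ i ≡ suc (toℕ j)
  Parent (inj₂ i) (inj₁ j) = i ≡ j
  Parent _        (inj₂ _) = ⊥

  parent? : ∀ u v → Dec (Parent u v)
  parent? (inj₁ i) (inj₁ j) = toℕ i ℕₚ.≟ suc (toℕ j)
  parent? (inj₂ i) (inj₁ j) = i Finₚ.≟ j
  parent? (inj₁ _) (inj₂ _) = no λ ()
  parent? (inj₂ _) (inj₂ _) = no λ ()

  rank : Fin n ⊎ Fin n → ℕ
  rank (inj₁ i) = toℕ i
  rank (inj₂ i) = suc (toℕ i)

  parent-rank : ∀ u v → Parent u v → rank v ℕ.< rank u
  parent-rank (inj₁ i) (inj₁ j) eq     = ℕₚ.≤-reflexive (≡.sym eq)
  parent-rank (inj₂ i) (inj₁ j) ≡.refl = ℕₚ.≤-refl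

  parent-functional : ∀ u v w → Parent u v → Parent u w → v ≡ w
  parent-functional (inj₁ i) (inj₁ j) (inj₁ k) eq eq′ = ≡.cong inj₁
    (Finₚ.toℕ-injective (ℕₚ.suc-injective (≡.trans (≡.sym eq) eq′)))
  parent-functional (inj₂ i) (inj₁ j) (inj₁ k) eq eq′ = ≡.cong inj₁ (≡.trans (≡.sym eq) eq′)

  Neighbours : Rel (Fin n ⊎ Fin n) 0ℓ
  Neighbours u v = Parent v u ⊎ Parent u v

  -- A record lets `u` and `v` be inferred from a proof of adjacency; the computed type
  -- `Neighbours (place u) (place v)` does not determine them.
  record Joined (u v : Vertex) : Set where
    constructor joined
    field neighbours : Neighbours (place u) (place v)

  graph : Graph
  graph = record
    { order      = n ℕ.+ n
    ; Adj        = Joined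
    ; adj?       = λ u v → map′ joined Joined.neighbours
                     (parent? (place v) (place u) ⊎-dec parent? (place u) (place v))
    ; adj-sym    = λ (joined nb) → joined (swap nb)
    ; adj-irrefl = λ
        { {u} ≡.refl (joined (inj₁ p)) → ℕₚ.<-irrefl ≡.refl (parent-rank (place u) (place u) p)
        ; {u} ≡.refl (joined (inj₂ p)) → ℕₚ.<-irrefl ≡.refl (parent-rank (place u) (place u) p) }
    }

  open Graph graph using (V; Adj; adj-sym; IsLeaf; IsCycle; Consecutive; InducesPath)

  acyclic : ∀ {k} (c : Fin (suc k) → V) → ¬ IsCycle c
  acyclic = rooted⇒acyclic graph (λ u v → Parent (place u) (place v)) (rank ∘ place)
      (λ (joined nb) → swap nb)
    (λ {u} {v} → parent-rank (place u) (place v))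
    (λ {u} {v} {w} p q → place-injective (parent-functional (place u) (place v) (place w) p q))

  adj-intro : ∀ {u v a b} → place u ≡ a → place v ≡ b → Neighbours a b → Adj u v
  adj-intro ≡.refl ≡.refl nb = joined nb

  adj-elim : ∀ {u v a b} → place u ≡ a → place v ≡ b → Adj u v → Neighbours a b
  adj-elim ≡.refl ≡.refl (joined nb) = nb

  spine-adj : ∀ i j → Adj (spine i) (spine j) ⇔ Consecutive i j
  spine-adj i j = mk⇔
    (adj-elim (place-spine i) (place-spine j)) (adj-intro (place-spine i) (place-spine j))

  leaf-adj : ∀ (i : Fin n) → Adj (leaf i) (spine i)
  leaf-adj i = adj-intro (place-leaf i) (place-spine i) (inj₂ ≡.refl)

  spine≢leaf : ∀ (i j : Fin n) → spine i ≢ leaf j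
  spine≢leaf i j eq = inj₁≢inj₂
    (≡.trans (≡.sym (place-spine i)) (≡.trans (≡.cong place eq) (place-leaf j)))
    where
    inj₁≢inj₂ : _≢_ {A = Fin n ⊎ Fin n} (inj₁ i) (inj₂ j)
    inj₁≢inj₂ ()

  leaf-injective : Injective _≡_ _≡_ leaf
  leaf-injective = Finₚ.↑ʳ-injective n _ _

  spine-neighbour : ∀ i → ∃ λ j → Adj (spine i) (spine j)
  spine-neighbour zero    = suc zero , Equivalence.from (spine-adj zero (suc zero)) (inj₁ ≡.refl)
  spine-neighbour (suc i) = inject₁ i , Equivalence.from (spine-adj (suc i) (inject₁ i))
    (inj₂ (≡.cong suc (≡.sym (Finₚ.toℕ-inject₁ i))))

  -- A spine vertex has its own pendant leaf and a neighbour on the spine. The latter exists because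
  -- the spine has at least two vertices; with one, both vertices of the graph would be leaves.
  spine-nonleaf : ∀ i → ¬ IsLeaf (spine i)
  spine-nonleaf i (w , _ , unique) with spine-neighbour i
  ... | j , ij = spine≢leaf j i (≡.trans (≡.sym (unique ij)) (unique (adj-sym (leaf-adj i))))

  leaf-isLeaf : ∀ (i : Fin n) → IsLeaf (leaf i)
  leaf-isLeaf i = spine i , leaf-adj i , λ {y} → unique y
    where
    unique : ∀ y → Adj (leaf i) y → spine i ≡ y
    unique y adj with place y in eq
    ... | inj₁ j with adj-elim (place-leaf i) eq adj
    ... | inj₂ ≡.refl = Finₚ.splitAt⁻¹-↑ˡ eq
    unique y adj | inj₂ j with adj-elim (place-leaf i) eq adj
    ... | inj₁ ()
    ... | inj₂ ()

  nonleaves-path : InducesPath (λ v → ¬ IsLeaf v)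
  nonleaves-path = n , spine , Finₚ.↑ˡ-injective n _ _ ,
    (λ v → mk⇔ (to v) λ { (i , ≡.refl) → spine-nonleaf i }) , spine-adj
    where
    to : ∀ v → ¬ IsLeaf v → ∃ λ i → spine i ≡ v
    to v nonleaf with place v in eq
    ... | inj₁ i = i , Finₚ.splitAt⁻¹-↑ˡ eq
    ... | inj₂ i = ⊥-elim (nonleaf (≡.subst IsLeaf (Finₚ.splitAt⁻¹-↑ʳ eq) (leaf-isLeaf i)))

  attach : Fin n ⊎ Fin n → Fin n
  attach = [ id , id ]′

  pendant : Fin n ⊎ Fin n → Carrier
  pendant = [ (λ _ → 0#) , leg ]′

  position : Fin n ⊎ Fin n → Carrier
  position = at ∘ attach

  pendant-nonneg : ∀ u → 0# ≤ pendant u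
  pendant-nonneg (inj₁ i) = ≤-refl
  pendant-nonneg (inj₂ i) = inj₁ (leg-pos i)

  -- The distance of two distinct vertices.
  gap : Fin n ⊎ Fin n → Fin n ⊎ Fin n → Carrier
  gap u v = pendant u + pendant v + ∣ position u - position v ∣

  gap-nonneg : ∀ u v → 0# ≤ gap u v
  gap-nonneg u v = 0≤-+ (0≤-+ (pendant-nonneg u) (pendant-nonneg v)) (0≤∣x∣ _)

  gap-sym : ∀ u v → gap u v ≈ gap v u
  gap-sym u v = +-cong (+-comm _ _) (∣∣-swap _ _)

  gap-triangle : ∀ u v w → gap u w ≤ gap u v + gap v w
  gap-triangle u v w = by-≤
    (∣∣-triangle (position u) (position v) (position w)
       ≤+≤ 0≤-+ (pendant-nonneg v) (pendant-nonneg v))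
    (solve 6 (λ a b c x y z → (x :+ y :+ (b :+ b)) :- (z :+ con (+ 0)) :=
                (a :+ b :+ x :+ (b :+ c :+ y)) :- (a :+ c :+ z)) refl _ _ _ _ _ _)

  parent-gap : ∀ u v → Parent u v → 0# < gap u v
  parent-gap (inj₁ i) (inj₁ j) eq = <-respʳ-≈ (sym
      (trans (+-congʳ (+-identityʳ 0#)) (+-identityˡ _)))
    (<-≤-trans (<⇒0<- (strictly-increasing ℝ at at-step (ℕₚ.≤-reflexive (≡.sym eq)))) (x≤∣x∣ _))
  parent-gap (inj₂ i) (inj₁ j) _ = by-< (leg-pos i <+≤ 0≤∣x∣ _)
    (solve 2 (λ l a → (l :+ a) :- (con (+ 0) :+ con (+ 0)) := (l :+ con (+ 0) :+ a) :- con (+ 0))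
      refl _ _)

  weightedGraph : WeightedGraph
  weightedGraph = record
    { graph          = graph
    ; edgeLength     = λ u v → gap (place u) (place v)
    ; edgeLength-sym = λ {u} {v} _ → gap-sym (place u) (place v)
    ; edgeLength-pos = λ
        { {u} {v} (joined (inj₁ p)) →
            <-respʳ-≈ (gap-sym (place v) (place u)) (parent-gap (place v) (place u) p)
        ; {u} {v} (joined (inj₂ p)) → parent-gap (place u) (place v) p }
    }

  open WeightedGraph weightedGraph using (walkLength; IsPathMetric; edgeLength-sym)

  -- `gap` of a leaf with itself is twice its leg, hence the separate value on the diagonal.
  dist : V → V → Carrier
  dist u v with u Finₚ.≟ v
  ... | yes _ = 0#
  ... | no  _ = gap (place u) (place v)

  dist-refl : ∀ u → dist u u ≈ 0#
  dist-refl u with u Finₚ.≟ u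
  ... | yes _  = refl
  ... | no u≢u = ⊥-elim (u≢u ≡.refl)

  dist-≢ : ∀ {u v} → u ≢ v → dist u v ≈ gap (place u) (place v)
  dist-≢ {u} {v} u≢v with u Finₚ.≟ v
  ... | yes u≡v = ⊥-elim (u≢v u≡v)
  ... | no  _   = refl

  WalkOfLength : V → V → Carrier → Set
  WalkOfLength u v x = Σ (Star Adj u v) λ w → x ≈ walkLength w

  edge-walk : ∀ {u v} → Adj u v → WalkOfLength u v (gap (place u) (place v))
  edge-walk uv = uv ◅ ε , sym (+-identityʳ _)

  infixr 5 _⋯_
  _⋯_ : ∀ {u v w x y} → WalkOfLength u v x → WalkOfLength v w y → WalkOfLength u w (x + y)
  (p , x≈) ⋯ (q , y≈) = p ◅◅ q , trans (+-cong x≈ y≈) (sym (walkLength-◅◅ p q))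
    where open TreeMetric ℝ weightedGraph

  reverse-walk : ∀ {u v x} → WalkOfLength u v x → WalkOfLength v u x
  reverse-walk (p , x≈) with TreeMetric.walkLength-reverse ℝ weightedGraph p
  ... | q , q≈ = q , trans x≈ (sym q≈)

  rescale : ∀ {u v x y} → x ≈ y → WalkOfLength u v x → WalkOfLength u v y
  rescale x≈y (p , eq) = p , trans (sym x≈y) eq

  spine-step : ∀ k → WalkOfLength (spine (inject₁ k)) (spine (suc k)) (at (suc k) - at (inject₁ k))
  spine-step k = rescale eq (edge-walk (Equivalence.from (spine-adj (inject₁ k) (suc k))
      (inj₁ (≡.cong suc (≡.sym (Finₚ.toℕ-inject₁ k))))))
    where
    eq : gap (place (spine (inject₁ k))) (place (spine (suc k))) ≈ at (suc k) - at (inject₁ k)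
    eq rewrite place-spine (inject₁ k) | place-spine (suc k) =
      trans (+-cong (+-identityʳ 0#)
        (trans (∣∣-swap _ _) (∣x∣≈x (inj₁ (<⇒0<- (at-step k)))))) (+-identityˡ _)

  spine-walk-up : ∀ {i j} → i Fin.≤ j → WalkOfLength (spine i) (spine j) (at j - at i)
  spine-walk-up {i} = <-weakInduction-startingFrom
    (λ j → WalkOfLength (spine i) (spine j) (at j - at i))
    (ε , -‿inverseʳ _)
    (λ k w → rescale (solve 3 (λ a b c → (b :- a) :+ (c :- b) := c :- a)
      refl _ _ _) (w ⋯ spine-step k))

  spine-walk : ∀ i j → WalkOfLength (spine i) (spine j) ∣ at i - at j ∣
  spine-walk i j with ℕₚ.≤-total (toℕ i) (toℕ j)
  ... | inj₁ i≤j = rescale (sym (trans (∣∣-swap _ _)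
        (∣x∣≈x (≤⇒0≤- (increasing ℝ at at-step i≤j))))) (spine-walk-up i≤j)
  ... | inj₂ j≤i = rescale (sym (∣x∣≈x (≤⇒0≤- (increasing ℝ at at-step j≤i))))
        (reverse-walk (spine-walk-up j≤i))

  leg-walk : ∀ u → WalkOfLength u (spine (attach (place u))) (pendant (place u))
  leg-walk u with place u in eq
  ... | inj₁ i = ≡.subst (λ v → WalkOfLength v (spine i) 0#) (Finₚ.splitAt⁻¹-↑ˡ eq) (ε , refl)
  ... | inj₂ i = ≡.subst (λ v → WalkOfLength v (spine i) (leg i)) (Finₚ.splitAt⁻¹-↑ʳ eq)
                   (rescale length (edge-walk (leaf-adj i)))
    where
    length : gap (place (leaf i)) (place (spine i)) ≈ leg i
    length rewrite place-leaf i | place-spine i =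
        trans (+-congˡ (∣x∣≈x (inj₂ (sym (-‿inverseʳ (at i))))))
      (solve 2 (λ l a → l :+ con (+ 0) :+ (a :- a) := l) refl _ _)

  gap-walk : ∀ u v → WalkOfLength u v (gap (place u) (place v))
  gap-walk u v = rescale
    (solve 3 (λ a b c → a :+ (c :+ b) := a :+ b :+ c) refl _ _ _)
    (leg-walk u ⋯ spine-walk (attach (place u)) (attach (place v)) ⋯ reverse-walk (leg-walk v))

  dist≤walk : ∀ {u v} (w : Star Adj u v) → dist u v ≤ walkLength w
  dist≤walk {u} ε = inj₂ (dist-refl u)
  dist≤walk {u} {v} (_◅_ {j = w} uw p) with u Finₚ.≟ v
  ... | yes _   = 0≤-+ (gap-nonneg (place u) (place w))
      (TreeMetric.walkLength-nonneg ℝ weightedGraph p)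
  ... | no  u≢v with w Finₚ.≟ v
  -- The rest of the walk is closed, and its distance is zero instead of a `gap`, so `gap-triangle`
  -- does not fit here. The first edge alone already has the required length.
  ... | yes ≡.refl = by-≤ (TreeMetric.walkLength-nonneg ℝ weightedGraph p)
        (solve 2 (λ a b → b :- con (+ 0) := (a :+ b) :- a) refl _ _)
  ... | no  w≢v = ≤-trans (gap-triangle (place u) (place w) (place v))
        (≤-refl ≤+≤ ≤-trans (inj₂ (sym (dist-≢ w≢v))) (dist≤walk p))

  isPathMetric : IsPathMetric dist
  isPathMetric = geodesic , dist≤walk
    where
    geodesic : ∀ u v → WalkOfLength u v (dist u v)
    geodesic u v with u Finₚ.≟ v
    ... | yes ≡.refl = ε , refl
    ... | no  _      = gap-walk u v

  caterpillar : Caterpillar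
  caterpillar = record
    { weightedGraph      = weightedGraph
    ; isCaterpillarGraph = (spine zero , (λ u v → proj₁ (gap-walk u v)) , acyclic) , nonleaves-path
    ; dist               = dist
    ; isPathMetric       = isPathMetric
    }

  leaf-dist : ∀ {i j} → i ≢ j → dist (leaf i) (leaf j) ≈ leg i + leg j + ∣ at i - at j ∣
  leaf-dist {i} {j} i≢j = trans (dist-≢ (i≢j ∘ leaf-injective)) gap-leaves
    where
    gap-leaves : gap (place (leaf i)) (place (leaf j)) ≈ leg i + leg j + ∣ at i - at j ∣
    gap-leaves rewrite place-leaf i | place-leaf j = refl

-- Matrix identities and the theorem of the alternative for positive vectors.

module LinearAlgebra (ℝ : RealNumbers) where
  open RealNumbers ℝ hiding (zero)
  open OrderedField ℝ
  open Definitions ℝ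
  open import Algebra.Properties.Semiring.Sum semiring
  open import Relation.Binary.Reasoning.Setoid setoid

  *ⱽ-assoc : ∀ {k m n} (M : Matrix k m) (N : Matrix m n) (x : Vector Carrier n) →
             ∀ i → ((M *ᴹ N) *ⱽ x) i ≈ (M *ⱽ (N *ⱽ x)) i
  *ⱽ-assoc {k} {m} {n} M N x i = begin
    sum (λ j → sum (λ c → M i c * N c j) * x j)
      ≈⟨ sum-cong-≋ {n} (λ j → *-distribʳ-sum {m} (x j) _) ⟩
    sum (λ j → sum (λ c → M i c * N c j * x j))
      ≈⟨ ∑-comm {n} {m} _ ⟩
    sum (λ c → sum (λ j → M i c * N c j * x j))
      ≈⟨ sum-cong-≋ {m} (λ c → trans (sum-cong-≋ {n} λ j → *-assoc _ _ _)
           (sym (*-distribˡ-sum {n} (M i c) _))) ⟩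
    sum (λ c → M i c * sum (λ j → N c j * x j)) ∎

  adjoint : ∀ {m n} (M : Matrix m n) (u : Vector Carrier m) (v : Vector Carrier n) →
            sum (λ i → u i * (M *ⱽ v) i) ≈ sum (λ j → (M ᵀ *ⱽ u) j * v j)
  adjoint {m} {n} M u v = begin
    sum (λ i → u i * sum (λ j → M i j * v j))
      ≈⟨ sum-cong-≋ {m} (λ i → *-distribˡ-sum {n} (u i) _) ⟩
    sum (λ i → sum (λ j → u i * (M i j * v j)))
      ≈⟨ ∑-comm {m} {n} _ ⟩
    sum (λ j → sum (λ i → u i * (M i j * v j)))
      ≈⟨ sum-cong-≋ {n} (λ j → trans (sum-cong-≋ {m} λ i →
           solve 3 (λ u M v → u :* (M :* v) := (M :* u) :* v) refl _ _ _)
           (sym (*-distribʳ-sum {m} (v j) _))) ⟩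
    sum (λ j → sum (λ i → M i j * u i) * v j) ∎

  *ⱽ-inverse : ∀ {n} {M M⁻¹ : Matrix n n} → M *ᴹ M⁻¹ ≈ᴹ 1ᴹ → ∀ x i → (M *ⱽ (M⁻¹ *ⱽ x)) i ≈ x i
  *ⱽ-inverse {n} {M} {M⁻¹} eq x i = begin
    (M *ⱽ (M⁻¹ *ⱽ x)) i   ≈⟨ *ⱽ-assoc M M⁻¹ x i ⟨
    ((M *ᴹ M⁻¹) *ⱽ x) i   ≈⟨ sum-cong-≋ {n} (λ j → *-congʳ (eq i j)) ⟩
    sum (λ j → 1ᴹ i j * x j) ≈⟨ sum-1ᴹ i x ⟩
    x i ∎

  sum-neg : ∀ {n} (f : Vector Carrier n) → sum (λ i → - f i) ≈ - sum f
  sum-neg {n} f = begin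
    sum (λ i → - f i)          ≈⟨ sum-cong-≋ {n} (λ i → solve 1
      (λ f → :- f := (:- con (+ 1)) :* f) refl _) ⟩
    sum (λ i → (- 1#) * f i)   ≈⟨ *-distribˡ-sum {n} (- 1#) f ⟨
    (- 1#) * sum f             ≈⟨ solve 1 (λ f → (:- con (+ 1)) :* f := :- f) refl _ ⟩
    - sum f                    ∎

  1ᴹ-nonneg : ∀ {n} (i : Fin n) → NonNegative (1ᴹ i)
  1ᴹ-nonneg i j with i Finₚ.≟ j
  ... | yes _ = inj₁ 0<1
  ... | no  _ = ≤-refl

  sum-1ᴹ≈1 : ∀ {n} (i : Fin n) → sum (1ᴹ i) ≈ 1#
  sum-1ᴹ≈1 {n} i = trans (sum-cong-≋ {n} λ j → sym (*-identityʳ _)) (sum-1ᴹ i (λ _ → 1#))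

  module _ {m n} (M : Matrix m n) where
    open Alternative ℝ

    -- The unit vectors demand positivity of `z` itself, the rows of `M` that of `M *ⱽ z`.
    rows : List (Vector Carrier n)
    rows = map 1ᴹ (allFin n) List.++ map M (allFin m)

    -- The coefficients of a cone element: `y` on the rows of `M`, and what remains of `v` on the
    -- unit vectors. `nonzero` says that the total weight is positive, which is still informative
    -- when `v` is zero.
    record Certificate (v : Vector Carrier n) : Set where
      field
        y        : Vector Carrier m
        y-nonneg : NonNegative y
        slack    : NonNegative (λ c → v c - (M ᵀ *ⱽ y) c)
        nonzero  : 0# < sum (λ c → v c - (M ᵀ *ⱽ y) c) + sum y

    certificate : ∀ {v} → Cone rows v → Certificate v
    certificate (gen v∈) with ∈-++⁻ (map 1ᴹ (allFin n)) v∈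
    ... | inj₁ v∈1 with ∈-map⁻ 1ᴹ v∈1
    ... | i , _ , ≡.refl = record
      { y        = λ _ → 0#
      ; y-nonneg = λ _ → ≤-refl
      ; slack    = λ c → ≤-trans (1ᴹ-nonneg i c) (inj₂ (sym (eq c)))
      ; nonzero  = <-respʳ-≈ (sym (trans
          (+-cong (trans (sum-cong-≋ {n} eq) (sum-1ᴹ≈1 i)) (sum-replicate-zero m))
            (+-identityʳ 1#))) 0<1
      }
      where
      eq : ∀ c → 1ᴹ i c - (M ᵀ *ⱽ (λ _ → 0#)) c ≈ 1ᴹ i c
      eq c = trans (+-congˡ (-‿cong (sum-zero {m} λ j → zeroʳ _)))
        (solve 1 (λ a → a :- con (+ 0) := a) refl _)
    certificate (gen v∈) | inj₂ v∈M with ∈-map⁻ M v∈M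
    ... | i , _ , ≡.refl = record
      { y        = 1ᴹ i
      ; y-nonneg = 1ᴹ-nonneg i
      ; slack    = λ c → inj₂ (sym (eq c))
      ; nonzero  = <-respʳ-≈ (sym
          (trans (+-cong (sum-zero {n} eq) (sum-1ᴹ≈1 i)) (+-identityˡ 1#))) 0<1
      }
      where
      eq : ∀ c → M i c - (M ᵀ *ⱽ 1ᴹ i) c ≈ 0#
      eq c = trans (+-congˡ (-‿cong (trans (sum-cong-≋ {m} λ j → *-comm _ _)
          (sum-1ᴹ i (λ j → M j c)))))
        (-‿inverseʳ _)
    certificate (combine {a} {b} {u} {v} 0<a 0<b cu cv) = record
      { y        = λ i → a * C.y i + b * D.y i
      ; y-nonneg = λ i → 0≤-+
          (*-nonneg (inj₁ 0<a) (C.y-nonneg i)) (*-nonneg (inj₁ 0<b) (D.y-nonneg i))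
      ; slack    = λ c → ≤-trans
          (0≤-+ (*-nonneg (inj₁ 0<a) (C.slack c)) (*-nonneg (inj₁ 0<b) (D.slack c)))
                           (inj₂ (sym (eq c)))
      ; nonzero  = <-respʳ-≈ (sym (trans
          (+-cong (trans (sum-cong-≋ {n} eq) (linear {n} _ _)) (linear {m} C.y D.y))
          (solve 6 (λ a b p q r s → (a :* p :+ b :* q) :+ (a :* r :+ b :* s) :=
            a :* (p :+ r) :+ b :* (q :+ s))
             refl a b _ _ _ _)))
          (0<-+ (*-pos 0<a C.nonzero) (*-pos 0<b D.nonzero))
      }
      where
      module C = Certificate (certificate cu)
      module D = Certificate (certificate cv)
      linear : ∀ {k} (f g : Vector Carrier k) →
               sum (λ c → a * f c + b * g c) ≈ a * sum f + b * sum g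
      linear {k} f g = trans (sum-lin {k} b (λ c → a * f c) g)
        (+-congʳ (sym (*-distribˡ-sum {k} a f)))
      eq : ∀ c → (a * u c + b * v c) - (M ᵀ *ⱽ (λ i → a * C.y i + b * D.y i)) c ≈
                 a * (u c - (M ᵀ *ⱽ C.y) c) + b * (v c - (M ᵀ *ⱽ D.y) c)
      eq c = trans (+-congˡ (-‿cong (trans (sum-cong-≋ {m} λ i →
          solve 5 (λ M a b x y → M :* (a :* x :+ b :* y) := a :* (M :* x) :+ b :* (M :* y))
            refl (M i c) a b (C.y i) (D.y i))
          (linear {m} _ _))))
        (solve 6 (λ a b u v p q → (a :* u :+ b :* v) :- (a :* p :+ b :* q) :=
          a :* (u :- p) :+ b :* (v :- q))
          refl a b _ _ _ _)
    certificate (resp {u} {v} u≈v cu) = record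
      { y        = C.y
      ; y-nonneg = C.y-nonneg
      ; slack    = λ c → ≤-trans (C.slack c) (inj₂ (+-congʳ (u≈v c)))
      ; nonzero  = <-respʳ-≈ (+-congʳ (sum-cong-≋ {n} λ c → +-congʳ (u≈v c))) C.nonzero
      }
      where module C = Certificate (certificate cu)

    positive-alternative :
      (∃ λ z → (∀ c → 0# < z c) × (∀ i → 0# < (M *ⱽ z) i)) ⊎
      (∃ λ y → NonNegative (λ c → - (M ᵀ *ⱽ y) c) × NonNegative y × ¬ IsZero y)
    positive-alternative with gordan rows
    ... | inj₁ (z , z-pos) = inj₁ (z ,
      (λ c → <-respʳ-≈ (sum-1ᴹ c z) (z-pos (∈-++⁺ˡ (∈-map⁺ 1ᴹ (∈-allFin c))))) ,
      (λ i → z-pos (∈-++⁺ʳ (map 1ᴹ (allFin n)) (∈-map⁺ M (∈-allFin i)))))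
    -- At the zero vector the slack is `- (M ᵀ *ⱽ y) c`. If `y` vanished, so would the slack, and
    -- with it the total weight.
    ... | inj₂ cone = inj₂ (C.y ,
        (λ c → ≤-trans (C.slack c) (inj₂ (+-identityˡ _))) , C.y-nonneg , λ y≈0 →
      irrefl (sym (trans (+-cong (sum-zero {n} λ c → trans (+-identityˡ _) (trans (-‿cong
          (sum-zero {m} λ i → trans (*-congˡ (y≈0 i)) (zeroʳ _)))
            (solve 0 (:- con (+ 0) := con (+ 0)) refl)))
        (sum-zero {m} y≈0)) (+-identityˡ _))) C.nonzero)
      where module C = Certificate (certificate cone)

-- The rows of the space, and duality between the two systems.

module System (ℝ : RealNumbers) {p : ℕ}
  (ρ : Fin (suc p) → Fin (suc p) → RealNumbers.Carrier ℝ)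
  (dis : Definitions.IsDissimilarity ℝ ρ) where

  open RealNumbers ℝ hiding (zero)
  open OrderedField ℝ
  open LinearAlgebra ℝ
  open Definitions ℝ hiding
    (h; l; L; R; A; B; N; Y; CloserToFirst; CloserToLast; closerToFirst?; closerToLast?;
    B⁻¹; B*B⁻¹; B⁻¹*B; eval-h; eval-l; eval-up; eval-down)
  private module D = Definitions ℝ
  open import Algebra.Properties.Semiring.Sum semiring
  open import Relation.Binary.Reasoning.Setoid setoid
  open Extrema (Finₚ.≤-totalOrder (suc p)) using (argmax-sel; argmin-sel; xs≤max; min≤xs)

  h l : Fin (suc p) → Form {p}
  h = D.h
  l = D.l

  L R : Fin (suc p) → Fin (suc p) → Fin (suc p)
  L = D.L ρ
  R = D.R ρ

  A : Fin (suc p) → Fin (suc p) → Form {p}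
  A = D.A {p} ρ

  B B⁻¹ : Matrix (p ℕ.+ p) (p ℕ.+ p)
  B   = D.B ρ
  B⁻¹ = D.B⁻¹ ρ dis

  N : Matrix (#N {p}) (p ℕ.+ p)
  N = D.N ρ

  Y : Matrix (p ℕ.+ p) (#N {p})
  Y = D.Y ρ dis

  CloserToFirst CloserToLast : (i k j : Fin (suc p)) → Set
  CloserToFirst = D.CloserToFirst ρ
  CloserToLast  = D.CloserToLast ρ

  L-spec : ∀ i k → L i k ≡ i ⊎ CloserToFirst i k (L i k)
  L-spec i k with argmax-sel id i (filter (D.closerToFirst? ρ i k) (allFin (suc p)))
  ... | inj₁ eq = inj₁ eq
  ... | inj₂ L∈ = inj₂ (proj₂ (∈-filter⁻ (D.closerToFirst? ρ i k) {xs = allFin (suc p)} L∈))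

  L-upper : ∀ {i k j} → CloserToFirst i k j → j Fin.≤ L i k
  L-upper {i} {k} closer = All.lookup (xs≤max i _)
    (∈-filter⁺ (D.closerToFirst? ρ i k) (∈-allFin _) closer)

  R-spec : ∀ i k → R k i ≡ k ⊎ CloserToLast i k (R k i)
  R-spec i k with argmin-sel id k (filter (D.closerToLast? ρ i k) (allFin (suc p)))
  ... | inj₁ eq = inj₁ eq
  ... | inj₂ R∈ = inj₂ (proj₂ (∈-filter⁻ (D.closerToLast? ρ i k) {xs = allFin (suc p)} R∈))

  R-lower : ∀ {i k j} → CloserToLast i k j → R k i Fin.≤ j
  R-lower {i} {k} closer = All.lookup (min≤xs k _)
    (∈-filter⁺ (D.closerToLast? ρ i k) (∈-allFin _) closer)

  Nonconsecutive : Fin (suc p) × Fin (suc p) → Set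
  Nonconsecutive (i , j) = 1 ℕ.< ℕ.∣ toℕ i - toℕ j ∣

  nonconsecutive? : ∀ ij → Dec (Nonconsecutive ij)
  nonconsecutive? (i , j) = 1 ℕₚ.<? ℕ.∣ toℕ i - toℕ j ∣

  pairs : List (Fin (suc p) × Fin (suc p))
  pairs = nonconsecutivePairs {p}

  N-row : ∀ i j → Nonconsecutive (i , j) → ∃ λ q → ∀ c → A i j c ≡ N q c
  N-row i j far = index ij∈ , λ c → ≡.cong (λ (i , j) → A i j c) (lookup-index ij∈)
    where
    ij∈ : (i , j) ∈ pairs
    ij∈ = ∈-filter⁺ nonconsecutive? (∈-cartesianProduct⁺ (∈-allFin i) (∈-allFin j)) far

  nonconsecutive-≢ : ∀ {i j} → Nonconsecutive (i , j) → i ≢ j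
  nonconsecutive-≢ {i} far ≡.refl = ℕₚ.n≮0 (≡.subst (1 ℕ.<_) (ℕₚ.∣n-n∣≡0 (toℕ i)) far)

  N-pair : ∀ (q : Fin (#N {p})) → Nonconsecutive (List.lookup pairs q)
  N-pair q = proj₂ (∈-filter⁻ nonconsecutive?
      {xs = cartesianProduct (allFin (suc p)) (allFin (suc p))}
    (∈-lookup {xs = pairs} q))

  -- By `adjoint` the inverse contained in `Y` moves across the pairing, where it meets `B *ⱽ x` and
  -- cancels `B`.
  Yᵀ-B : ∀ (x : Form {p}) q → (Y ᵀ *ⱽ (B *ⱽ x)) q ≈ - (N *ⱽ x) q
  Yᵀ-B x q = begin
    sum (λ c → - (B⁻¹ ᵀ *ⱽ N q) c * (B *ⱽ x) c)
      ≈⟨ sum-cong-≋ {p ℕ.+ p} (λ c → solve 2 (λ a b → (:- a) :* b := :- (b :* a)) refl _ _) ⟩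
    sum (λ c → - ((B *ⱽ x) c * (B⁻¹ ᵀ *ⱽ N q) c))
      ≈⟨ sum-neg {p ℕ.+ p} _ ⟩
    - sum (λ c → (B *ⱽ x) c * (B⁻¹ ᵀ *ⱽ N q) c)
      ≈⟨ -‿cong (adjoint (B⁻¹ ᵀ) (B *ⱽ x) (N q)) ⟩
    - sum (λ k → (B⁻¹ *ⱽ (B *ⱽ x)) k * N q k)
      ≈⟨ -‿cong (sum-cong-≋ {p ℕ.+ p} λ k →
           trans (*-congʳ (*ⱽ-inverse {M = B⁻¹} {B} (D.B⁻¹*B ρ dis) x k)) (*-comm _ _)) ⟩
    - (N *ⱽ x) q ∎

  module _ (x : Form {p}) (B-pos : ∀ c → 0# < (B *ⱽ x) c) (N-pos : ∀ q → 0# < (N *ⱽ x) q) where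

    -- Pairing the two systems gives 0 ≤ (B x) · (Y y) = - (N x) · y ≤ 0. Hence every term of the
    -- last sum is zero, and positivity of N x leaves only y = 0.
    feasible⇒infeasible : ¬ ∃ λ y → NonNegative (Y *ⱽ y) × NonNegative y × ¬ IsZero y
    feasible⇒infeasible (y , Yy≥0 , y≥0 , y≉0) = y≉0 λ q → cancel q (nonneg-sum≤0⇒0 Nxy≥0 Σ≤0 q)
      where
      Nxy≥0 : NonNegative (λ q → (N *ⱽ x) q * y q)
      Nxy≥0 q = *-nonneg (inj₁ (N-pos q)) (y≥0 q)
      eq : sum (λ c → (B *ⱽ x) c * (Y *ⱽ y) c) ≈ - sum (λ q → (N *ⱽ x) q * y q)
      eq = trans (adjoint Y (B *ⱽ x) y) (trans
        (sum-cong-≋ {#N {p}} λ q → trans (*-congʳ (Yᵀ-B x q))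
          (solve 2 (λ a b → (:- a) :* b := :- (a :* b)) refl _ _))
        (sum-neg {#N {p}} _))
      Σ≤0 : sum (λ q → (N *ⱽ x) q * y q) ≤ 0#
      Σ≤0 = by-≤ (≤-trans (sum-nonneg λ c → *-nonneg (inj₁ (B-pos c)) (Yy≥0 c)) (inj₂ eq))
        (solve 1 (λ s → :- s :- con (+ 0) := con (+ 0) :- s) refl _)
      cancel : ∀ q → (N *ⱽ x) q * y q ≈ 0# → y q ≈ 0#
      cancel q eq0 with y≥0 q
      ... | inj₁ 0<y = ⊥-elim (irrefl (sym eq0) (*-pos (N-pos q) 0<y))
      ... | inj₂ 0≈y = sym 0≈y

  infeasible⇒feasible : ¬ (∃ λ y → NonNegative (Y *ⱽ y) × NonNegative y × ¬ IsZero y) →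
    ∃ λ x → (∀ c → 0# < (B *ⱽ x) c) × (∀ q → 0# < (N *ⱽ x) q)
  infeasible⇒feasible infeasible with positive-alternative {#N {p}} {p ℕ.+ p} (-ᴹ (Y ᵀ))
  ... | inj₂ (y , Yy≥0 , y≥0 , y≉0) = ⊥-elim (infeasible (y ,
      (λ c → ≤-trans (Yy≥0 c) (inj₂ (eq c))) , y≥0 , y≉0))
    where
    eq : ∀ c → - (((-ᴹ (Y ᵀ)) ᵀ) *ⱽ y) c ≈ (Y *ⱽ y) c
    eq c = trans (sym (sum-neg {#N {p}} _)) (sum-cong-≋ {#N {p}} λ q →
      solve 2 (λ a b → :- ((:- a) :* b) := a :* b) refl _ _)
  -- As `B` is invertible, every `z` is of the form `B *ⱽ x`, so nothing is lost by having solved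
  -- for `z`.
  ... | inj₁ (z , z-pos , Mz-pos) = B⁻¹ *ⱽ z , (λ c → <-respʳ-≈ (sym (BB⁻¹z c)) (z-pos c)) ,
                                    (λ q → <-respʳ-≈ (eq q) (Mz-pos q))
    where
    BB⁻¹z : ∀ c → (B *ⱽ (B⁻¹ *ⱽ z)) c ≈ z c
    BB⁻¹z = *ⱽ-inverse {M = B} {B⁻¹} (D.B*B⁻¹ ρ dis) z
    eq : ∀ q → ((-ᴹ (Y ᵀ)) *ⱽ z) q ≈ (N *ⱽ (B⁻¹ *ⱽ z)) q
    eq q = trans (trans
        (sum-cong-≋ {p ℕ.+ p} λ c → trans (*-congˡ (sym (BB⁻¹z c)))
          (solve 2 (λ a b → (:- a) :* b := :- (a :* b)) refl _ _))
        (sum-neg {p ℕ.+ p} _))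
      (trans (-‿cong (Yᵀ-B (B⁻¹ *ⱽ z) q)) (solve 1 (λ a → :- :- a := a) refl _))

  -- α and β are the values of h₁, …, hₙ and l₁, …, lₙ at x.
  module _ (x : Form {p}) (α β : Fin (suc p) → Carrier) (α₀ : α zero ≈ 0#) (β₀ : β zero ≈ 0#)
           (x-h : ∀ k → x (k ↑ˡ p) ≈ α (suc k)) (x-l : ∀ k → x (p ↑ʳ k) ≈ β (suc k)) where

    private
      H = λ i → λ c → h i c * x c
      Λ = λ i → λ c → l i c * x c
      eval-h = D.eval-h {p} ρ dis x α β α₀ β₀ x-h x-l
      eval-l = D.eval-l {p} ρ dis x α β α₀ β₀ x-h x-l

    -- A common shape for both kinds of rows, which differ only in the five coefficients.
    combination : ∀ a b d s t i j k →
      sum (λ c → (a * h i c + b * h j c + d * h k c + s * l i c + t * l j c) * x c) ≈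
      a * α i + b * α j + d * α k + s * β i + t * β j
    combination a b d s t i j k = begin
      sum (λ c → (a * h i c + b * h j c + d * h k c + s * l i c + t * l j c) * x c)
        ≈⟨ sum-cong-≋ {p ℕ.+ p} (λ c → solve 11 (λ a b d s t u v w y z x →
             (a :* u :+ b :* v :+ d :* w :+ s :* y :+ t :* z) :* x :=
             a :* (u :* x) :+ b :* (v :* x) :+ d :* (w :* x) :+ s :* (y :* x) :+ t :* (z :* x)) refl
             a b d s t (h i c) (h j c) (h k c) (l i c) (l j c) (x c)) ⟩
      sum (λ c → a * H i c + b * H j c + d * H k c + s * Λ i c + t * Λ j c)
        ≈⟨ trans (sum-lin {p ℕ.+ p} t _ (Λ j)) (+-congʳ
          (trans (sum-lin {p ℕ.+ p} s _ (Λ i)) (+-congʳ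
             (trans (sum-lin {p ℕ.+ p} d _ (H k)) (+-congʳ (trans (sum-lin {p ℕ.+ p} b _ (H j))
               (+-congʳ (sym (*-distribˡ-sum {p ℕ.+ p} a (H i)))))))))) ⟩
      a * sum (H i) + b * sum (H j) + d * sum (H k) + s * sum (Λ i) + t * sum (Λ j)
        ≈⟨ +-cong (+-cong (+-cong (+-cong (*-congˡ (eval-h i)) (*-congˡ (eval-h j)))
             (*-congˡ (eval-h k))) (*-congˡ (eval-l i))) (*-congˡ (eval-l j)) ⟩
      a * α i + b * α j + d * α k + s * β i + t * β j ∎

    row-up : ∀ {i j} → i Fin.< j → sum (λ c → A i j c * x c) ≈
             α i + α j - 2# * α (L i j) - β i + β j
    row-up {i} {j} i<j = trans
      (trans (sum-cong-≋ {p ℕ.+ p}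
        (λ c → *-congʳ (eq c))) (combination 1# 1# (- 2#) (- 1#) 1# i j (L i j)))
      (solve 5 (λ a b d s t → con (+ 1) :* a :+ con (+ 1) :* b :+ (:- con (+ 2)) :* d :+
        (:- con (+ 1)) :* s :+ con (+ 1) :* t :=
         a :+ b :- con (+ 2) :* d :- s :+ t) refl _ _ _ _ _)
      where
      eq : ∀ c → A i j c ≈ 1# * h i c + 1# * h j c + - 2# * h (L i j) c + - 1# * l i c + 1# * l j c
      eq c with Finₚ.<-cmp i j
      ... | tri< _ _ _ = solve 5 (λ a b d s t → a :+ b :- con (+ 2) :* d :- s :+ t :=
        con (+ 1) :* a :+ con (+ 1) :* b :+ (:- con (+ 2)) :* d :+ (:- con (+ 1)) :* s :+
          con (+ 1) :* t) refl _ _ _ _ _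
      ... | tri≈ ≮ _ _ = ⊥-elim (≮ i<j)
      ... | tri> ≮ _ _ = ⊥-elim (≮ i<j)

    row-down : ∀ {i j} → i Fin.< j → sum (λ c → A j i c * x c) ≈
               - α i - α j + 2# * α (R j i) + β i - β j
    row-down {i} {j} i<j = trans
      (trans (sum-cong-≋ {p ℕ.+ p}
        (λ c → *-congʳ (eq c))) (combination (- 1#) (- 1#) 2# 1# (- 1#) i j (R j i)))
      (solve 5 (λ a b d s t → (:- con (+ 1)) :* a :+ (:- con (+ 1)) :* b :+ con (+ 2) :* d :+
        con (+ 1) :* s :+ (:- con (+ 1)) :* t :=
         :- a :- b :+ con (+ 2) :* d :+ s :- t) refl _ _ _ _ _)
      where
      eq : ∀ c → A j i c ≈ - 1# * h i c + - 1# * h j c + 2# * h (R j i) c +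
               1# * l i c + - 1# * l j c
      eq c with Finₚ.<-cmp j i
      ... | tri> _ _ _ = solve 5 (λ a b d s t → :- a :- b :+ con (+ 2) :* d :+ s :- t :=
        (:- con (+ 1)) :* a :+ (:- con (+ 1)) :* b :+ con (+ 2) :* d :+ con (+ 1) :* s :+
          (:- con (+ 1)) :* t) refl _ _ _ _ _
      ... | tri≈ _ _ ≮ = ⊥-elim (≮ i<j)
      ... | tri< _ _ ≮ = ⊥-elim (≮ i<j)

-- From a drawing to a solution of the rows.

module Drawings (ℝ : RealNumbers) {p : ℕ} (ρ : Fin (suc p) → Fin (suc p) → RealNumbers.Carrier ℝ)
  (dis : Definitions.IsDissimilarity ℝ ρ)
  (compatible : Definitions.Compatible ℝ _<ᶠ_ ρ) where

  open RealNumbers ℝ hiding (zero)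
  open OrderedField ℝ
  open System ℝ ρ dis
  private module D = Definitions ℝ
  open D.IsDissimilarity dis
  open D using (_*ⱽ_; ∀-++; Form)
  open import Algebra.Properties.Semiring.Sum semiring

  private
    last : Fin (suc p)
    last = fromℕ p

  module FromDrawing (strict : D.IsStrict ρ) (C : D.Caterpillar)
    (I : Fin (suc p) → D.Caterpillar.V C)
    (valid : D.IsValidDrawing ρ (D.Caterpillar.dist C) I) where

    private
      module C = D.Caterpillar C
      module T = TreeMetric ℝ C.weightedGraph
      acyclic : ∀ {k} (c : Fin (suc k) → C.V) → ¬ C.IsCycle c
      acyclic = proj₂ (proj₂ (proj₁ C.isCaterpillarGraph))

      d : Fin (suc p) → Fin (suc p) → Carrier
      d i j = C.dist (I i) (I j)

      d-mono : ∀ {x y z} → ρ x y < ρ x z → d x y < d x z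
      d-mono = proj₂ valid _ _ _

      d-sym : ∀ i j → d i j ≈ d j i
      d-sym i j = T.dist-sym acyclic C.dist C.isPathMetric (I i) (I j)

    -- Compatibility gives only the weak inequality; equality would identify the values of two
    -- distinct pairs, against strictness. For `a` equal to `i` the left side is zero.
    ρ-left : ∀ {a i j} → a Fin.≤ i → i Fin.< j → ρ a i < ρ a j
    ρ-left {a} {i} {j} a≤i i<j with ℕₚ.m≤n⇒m<n∨m≡n a≤i
    ... | inj₁ a<i with proj₁ (compatible a<i i<j)
    ...   | inj₁ lt = lt
    ...   | inj₂ eq = ⊥-elim (strict a i a j
              (λ { (inj₁ (_ , i≡j)) → Finₚ.<⇒≢ i<j i≡j ; (inj₂ (_ , i≡a)) →
                 Finₚ.<⇒≢ a<i (≡.sym i≡a) })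
              (inj₁ (Finₚ.<⇒≢ a<i)) eq)
    ρ-left {a} {i} {j} a≤i i<j | inj₂ a≡i with Finₚ.toℕ-injective a≡i | nonneg a j
    ... | ≡.refl | inj₁ 0<ρ = <-respˡ-≈ (sym (ρ-diag a)) 0<ρ
    ... | ≡.refl | inj₂ 0≈ρ = ⊥-elim (Finₚ.<⇒≢ i<j (ρ≈0⇒≡ (sym 0≈ρ)))

    ρ-right : ∀ {i j b} → i Fin.< j → j Fin.≤ b → ρ b j < ρ b i
    ρ-right {i} {j} {b} i<j j≤b with ℕₚ.m≤n⇒m<n∨m≡n j≤b
    ... | inj₁ j<b with proj₂ (compatible i<j j<b)
    ...   | inj₁ lt = <-respˡ-≈ (ρ-sym j b) (<-respʳ-≈ (ρ-sym i b) lt)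
    ...   | inj₂ eq = ⊥-elim (strict j b i b
              (λ { (inj₁ (j≡i , _)) → Finₚ.<⇒≢ i<j (≡.sym j≡i) ; (inj₂ (j≡b , _)) →
                 Finₚ.<⇒≢ j<b j≡b })
              (inj₁ (Finₚ.<⇒≢ j<b)) eq)
    ρ-right {i} {j} {b} i<j j≤b | inj₂ j≡b with Finₚ.toℕ-injective j≡b | nonneg j i
    ... | ≡.refl | inj₁ 0<ρ = <-respˡ-≈ (sym (ρ-diag j)) 0<ρ
    ... | ≡.refl | inj₂ 0≈ρ = ⊥-elim (Finₚ.<⇒≢ i<j (≡.sym (ρ≈0⇒≡ (sym 0≈ρ))))

    U V : Fin (suc p) → Carrier
    U i = d zero i
    V i = d i last

    U-mono : ∀ {i j} → i Fin.< j → U i < U j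
    U-mono i<j = d-mono (ρ-left ℕ.z≤n i<j)

    V-anti : ∀ {i j} → i Fin.< j → V j < V i
    V-anti {i} {j} i<j = <-respˡ-≈ (d-sym last j) (<-respʳ-≈ (d-sym last i)
      (d-mono (ρ-right i<j (Finₚ.≤fromℕ j))))

    d-formula : ∀ {i j} → i Fin.< j → U j + V i ≈ U last + d i j
    d-formula i<j = T.four-point acyclic C.dist C.isPathMetric (U-mono i<j <+< V-anti i<j)

    -- The constants are subtracted to get h 1 = l 1 = 0.
    α β : Fin (suc p) → Carrier
    α i = (U i - V i) - (U zero - V zero)
    β i = (U i + V i) - (U zero + V zero)

    x : Form {p}
    x = (α ∘ suc) Vector.++ (β ∘ suc)

    x-h : ∀ k → x (k ↑ˡ p) ≈ α (suc k)
    x-h k = reflexive (Vectorₚ.lookup-++ˡ (α ∘ suc) (β ∘ suc) k)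

    x-l : ∀ k → x (p ↑ʳ k) ≈ β (suc k)
    x-l k = reflexive (Vectorₚ.lookup-++ʳ (α ∘ suc) (β ∘ suc) k)

    -- At `x` the two kinds of consecutive rows are twice the increase of `U` and twice the decrease
    -- of `V`.
    B-pos : ∀ c → 0# < (B *ⱽ x) c
    B-pos = ∀-++ (λ c → 0# < (B *ⱽ x) c)
      (λ k → <-respʳ-≈ (sym (trans (D.eval-up ρ dis x α β (-‿inverseʳ _) (-‿inverseʳ _) x-h x-l k)
          (solve 6 (λ u v u′ v′ c e → (((u′ :- v′) :- c) :- ((u :- v) :- c)) :+ (((u′ :+ v′) :- e)
            :- ((u :+ v) :- e)) :=
             con (+ 2) :* (u′ :- u)) refl _ _ _ _ _ _)))
        (*-pos 0<2 (<⇒0<- (U-mono (D.inject₁<suc ρ dis k)))))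
      (λ k → <-respʳ-≈ (sym (trans (D.eval-down ρ dis x α β (-‿inverseʳ _) (-‿inverseʳ _) x-h x-l k)
          (solve 6 (λ u v u′ v′ c e → (((u′ :- v′) :- c) :- ((u :- v) :- c)) :- (((u′ :+ v′) :- e)
            :- ((u :+ v) :- e)) :=
             con (+ 2) :* (v :- v′)) refl _ _ _ _ _ _)))
        (*-pos 0<2 (<⇒0<- (V-anti (D.inject₁<suc ρ dis k)))))

    -- This is half the value of row (i , j) at `x`. With centre `i` it is the increase of `U`; the
    -- centre cannot be `j`, as `ρ i j` is not below `ρ j j`.
    row-up-pos : ∀ {i j} → i Fin.< j → 0# < U j - V i - U (L i j) + V (L i j)
    row-up-pos {i} {j} i<j with L-spec i j
    ... | inj₁ eq rewrite eq = <-respʳ-≈ (solve 3 (λ a b c → c :- b := c :- a :- b :+ a) refl _ _ _)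
          (<⇒0<- (U-mono i<j))
    ... | inj₂ (i≤L , L≤j , lt) with ℕₚ.m≤n⇒m<n∨m≡n i≤L | ℕₚ.m≤n⇒m<n∨m≡n L≤j
    ... | inj₂ i≡L | _ rewrite ≡.sym (Finₚ.toℕ-injective i≡L) =
          <-respʳ-≈ (solve 3 (λ a b c → c :- b := c :- a :- b :+ a) refl _ _ _) (<⇒0<- (U-mono i<j))
    ... | _ | inj₂ L≡j = ⊥-elim (D.ρ≮ρ-diag ρ dis i (L i j) j
          (≡.subst (λ k → ρ i (L i j) < ρ k j) (Finₚ.toℕ-injective L≡j) lt))
    -- Subtracting `d-formula i<L` from `d-formula L<j` removes `U last` and leaves the difference
    -- of the two distances from the centre.
    ... | inj₁ i<L | inj₁ L<j = by-< (d-mono (<-respˡ-≈ (ρ-sym i (L i j)) lt)) (trans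
          (+-congˡ (-‿cong (d-sym (L i j) i)))
          (trans (solve 3 (λ a b c → a :- b := (c :+ a) :- (c :+ b)) refl _ _ (U last))
          (trans (sym (+-cong (d-formula L<j) (-‿cong (d-formula i<L))))
            (solve 4 (λ a b c e → (a :+ b) :- (c :+ e) := (a :- e :- c :+ b) :- con (+ 0))
              refl _ _ _ _))))

    row-down-pos : ∀ {i j} → i Fin.< j → 0# < V i - U j + U (R j i) - V (R j i)
    row-down-pos {i} {j} i<j with R-spec i j
    ... | inj₁ eq rewrite eq = <-respʳ-≈ (solve 3 (λ a b c → a :- b := a :- c :+ c :- b) refl _ _ _)
          (<⇒0<- (V-anti i<j))
    ... | inj₂ (i≤R , R≤j , lt) with ℕₚ.m≤n⇒m<n∨m≡n i≤R | ℕₚ.m≤n⇒m<n∨m≡n R≤j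
    ... | _ | inj₂ R≡j rewrite Finₚ.toℕ-injective R≡j =
          <-respʳ-≈ (solve 3 (λ a b c → a :- b := a :- c :+ c :- b) refl _ _ _) (<⇒0<- (V-anti i<j))
    ... | inj₂ i≡R | _ = ⊥-elim (D.ρ≮ρ-diag ρ dis (R j i) j i
          (≡.subst (λ k → ρ (R j i) j < ρ i k) (≡.sym (Finₚ.toℕ-injective i≡R)) lt))
    ... | inj₁ i<R | inj₁ R<j = by-< (d-mono (<-respʳ-≈ (ρ-sym i (R j i)) lt)) (trans
          (+-congʳ (d-sym (R j i) i))
          (trans (solve 3 (λ a b c → a :- b := (c :+ a) :- (c :+ b)) refl _ _ (U last))
          (trans (sym (+-cong (d-formula i<R) (-‿cong (d-formula R<j))))
            (solve 4 (λ a b c e → (a :+ b) :- (c :+ e) := (b :- c :+ a :- e) :- con (+ 0))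
              refl _ _ _ _))))

    row-pos : ∀ i j → i ≢ j → 0# < sum (λ c → A i j c * x c)
    row-pos i j i≢j with ℕₚ.≤-total (toℕ i) (toℕ j)
    ... | inj₁ i≤j = <-respʳ-≈ (sym (trans (row-up x α β (-‿inverseʳ _) (-‿inverseʳ _) x-h x-l i<j)
          (solve 8 (λ ui vi uj vj uk vk c e →
             ((ui :- vi) :- c) :+ ((uj :- vj) :- c) :- con (+ 2) :* ((uk :- vk) :- c) :-
                 ((ui :+ vi) :- e) :+ ((uj :+ vj) :- e) :=
             con (+ 2) :* (uj :- vi :- uk :+ vk))
               refl (U i) (V i) (U j) (V j) (U (L i j)) (V (L i j)) _ _)))
          (*-pos 0<2 (row-up-pos i<j))
      where i<j = Finₚ.≤∧≢⇒< i≤j i≢j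
    ... | inj₂ j≤i = <-respʳ-≈ (sym
        (trans (row-down x α β (-‿inverseʳ _) (-‿inverseʳ _) x-h x-l j<i)
          (solve 8 (λ ui vi uj vj uk vk c e →
             :- ((ui :- vi) :- c) :- ((uj :- vj) :- c) :+ con (+ 2) :* ((uk :- vk) :- c) :+
               ((ui :+ vi) :- e) :- ((uj :+ vj) :- e) :=
             con (+ 2) :* (vi :- uj :+ uk :- vk))
               refl (U j) (V j) (U i) (V i) (U (R i j)) (V (R i j)) _ _)))
          (*-pos 0<2 (row-down-pos j<i))
      where j<i = Finₚ.≤∧≢⇒< j≤i (i≢j ∘ ≡.sym)

    N-pos : ∀ q → 0# < (N *ⱽ x) q
    N-pos q = row-pos i j (nonconsecutive-≢ {i} {j} (N-pair q))
      where
      i = proj₁ (List.lookup pairs q)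
      j = proj₂ (List.lookup pairs q)

-- From a solution of the rows to a drawing by the leaves of a caterpillar.

module ToDrawing (ℝ : RealNumbers) {m : ℕ}
  (ρ : Fin (suc (suc m)) → Fin (suc (suc m)) → RealNumbers.Carrier ℝ)
  (dis : Definitions.IsDissimilarity ℝ ρ) (compatible : Definitions.Compatible ℝ _<ᶠ_ ρ)
  (x : Definitions.Form ℝ {suc m})
  (B-pos : ∀ c → RealNumbers._<_ ℝ (RealNumbers.0# ℝ) (Definitions._*ⱽ_ ℝ (System.B ℝ ρ dis) x c))
  (N-pos : ∀ q → RealNumbers._<_ ℝ (RealNumbers.0# ℝ) (Definitions._*ⱽ_ ℝ (System.N ℝ ρ dis) x q))
      where

  open RealNumbers ℝ hiding (zero)
  open OrderedField ℝ
  open System ℝ ρ dis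
  private module D = Definitions ℝ
  open D.IsDissimilarity dis
  open D using (2#)
  open import Algebra.Properties.Semiring.Sum semiring

  private
    p : ℕ
    p = suc m

  α β : Fin (suc p) → Carrier
  α zero    = 0#
  α (suc k) = x (k ↑ˡ p)
  β zero    = 0#
  β (suc k) = x (p ↑ʳ k)

  α+β-step : ∀ k → α (inject₁ k) + β (inject₁ k) < α (suc k) + β (suc k)
  α+β-step k = by-< (<-respʳ-≈ (D.eval-up ρ dis x α β refl refl
      (λ _ → refl) (λ _ → refl) k) (B-pos (k ↑ˡ p)))
    (solve 4 (λ a a′ b b′ → ((a′ :- a) :+ (b′ :- b)) :- con (+ 0) := (a′ :+ b′) :- (a :+ b))
      refl _ _ _ _)

  α-β-step : ∀ k → α (inject₁ k) - β (inject₁ k) < α (suc k) - β (suc k)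
  α-β-step k = by-< (<-respʳ-≈ (D.eval-down ρ dis x α β refl refl
      (λ _ → refl) (λ _ → refl) k) (B-pos (p ↑ʳ k)))
    (solve 4 (λ a a′ b b′ → ((a′ :- a) :- (b′ :- b)) :- con (+ 0) := (a′ :- b′) :- (a :- b))
      refl _ _ _ _)

  -- The sum of rows (k , k + 1) and (k + 1 , k) is twice this step, which becomes the length of a
  -- spine edge.
  α-step : ∀ k → α (inject₁ k) < α (suc k)
  α-step k = by-< (half-pos (<-respʳ-≈
      (solve 4 (λ a a′ b b′ → ((a′ :+ b′) :+ (a′ :- b′)) :- ((a :+ b) :+ (a :- b)) :=
        con (+ 2) :* (a′ :- a)) refl _ _ _ _)
      (<⇒0<- (α+β-step k <+< α-β-step k))))
    (solve 2 (λ a b → (b :- a) :- con (+ 0) := b :- a) refl _ _)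

  α-increasing : ∀ {i j} → i Fin.≤ j → α i ≤ α j
  α-increasing = increasing ℝ α α-step

  row : ∀ i j → Nonconsecutive (i , j) → 0# < sum (λ c → A i j c * x c)
  row i j far with N-row i j far
  ... | q , eq = <-respʳ-≈ (sum-cong-≋ {p ℕ.+ p} λ c → *-congʳ {x c} (reflexive (≡.sym (eq c))))
      (N-pos q)

  -- A point strictly in between puts both orders of the outer pair among the rows of `N`.
  straddle : ∀ {i j k : Fin (suc p)} → i Fin.< j → j Fin.< k →
      Nonconsecutive (i , k) × Nonconsecutive (k , i)
  straddle {i} {j} {k} i<j j<k = far , ≡.subst (1 ℕ.<_) (ℕₚ.∣-∣-comm (toℕ i) (toℕ k)) far
    where
    far : 1 ℕ.< ℕ.∣ toℕ i - toℕ k ∣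
    far = ≡.subst (1 ℕ.<_) (≡.sym (ℕₚ.m≤n⇒∣m-n∣≡n∸m (ℕₚ.<⇒≤ (ℕₚ.<-trans i<j j<k))))
      (ℕₚ.m+n≤o⇒m≤o∸n 2 (ℕₚ.≤-trans (ℕ.s≤s i<j) j<k))

  -- Row (i , k) has centre `L i k`. The point `j` competes in that maximum, so it is at most
  -- `L i k`; as `α` increases, moving the centre down to `j` can only enlarge the row.
  straddle-up : ∀ {i j k} → i Fin.< j → j Fin.< k → ρ i j < ρ j k →
      0# < α i + α k - 2# * α j - β i + β k
  straddle-up {i} {j} {k} i<j j<k lt = by-<
    (<-respʳ-≈ (row-up x α β refl refl
      (λ _ → refl) (λ _ → refl) (ℕₚ.<-trans i<j j<k)) (row i k (proj₁ (straddle i<j j<k)))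
      <+≤ *-nonneg (inj₁ 0<2) (≤⇒0≤- (α-increasing (L-upper (ℕₚ.<⇒≤ i<j , ℕₚ.<⇒≤ j<k , lt)))))
    (solve 6 (λ ai ak aL aj bi bk → (ai :+ ak :- con (+ 2) :* aL :- bi :+ bk :+ con (+ 2) :*
      (aL :- aj)) :- (con (+ 0) :+ con (+ 0)) :=
      (ai :+ ak :- con (+ 2) :* aj :- bi :+ bk) :- con (+ 0)) refl _ _ _ _ _ _)

  straddle-down : ∀ {i j k} → i Fin.< j → j Fin.< k → ρ j k < ρ i j →
      0# < - α i - α k + 2# * α j + β i - β k
  straddle-down {i} {j} {k} i<j j<k lt = by-<
    (<-respʳ-≈ (row-down x α β refl refl
      (λ _ → refl) (λ _ → refl) (ℕₚ.<-trans i<j j<k)) (row k i (proj₂ (straddle i<j j<k)))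
      <+≤ *-nonneg (inj₁ 0<2) (≤⇒0≤- (α-increasing (R-lower (ℕₚ.<⇒≤ i<j , ℕₚ.<⇒≤ j<k , lt)))))
    (solve 6 (λ ai ak aR aj bi bk → (:- ai :- ak :+ con (+ 2) :* aR :+ bi :- bk :+ con (+ 2) :*
      (aj :- aR)) :- (con (+ 0) :+ con (+ 0)) :=
      (:- ai :- ak :+ con (+ 2) :* aj :+ bi :- bk) :- con (+ 0)) refl _ _ _ _ _ _)

  -- The rows determine l only up to an additive constant, chosen here so
  -- that all legs are positive.
  shift : ∃ λ c → ∀ i → - β i < c
  shift = upper-bound (λ i → - β i)

  leg : Fin (suc p) → Carrier
  leg i = β i + proj₁ shift

  leg-pos : ∀ i → 0# < leg i
  leg-pos i = by-< (proj₂ shift i) (solve 2 (λ b c → c :- :- b := (b :+ c) :- con (+ 0)) refl _ _)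

  open Caterpillars ℝ α leg α-step leg-pos

  leaf-dist-< : ∀ {i j} → i Fin.< j → dist (leaf i) (leaf j) ≈ leg i + leg j + (α j - α i)
  leaf-dist-< i<j = trans (leaf-dist (Finₚ.<⇒≢ i<j))
    (+-congˡ (trans (∣∣-swap _ _) (∣x∣≈x (≤⇒0≤- (α-increasing (ℕₚ.<⇒≤ i<j))))))

  leaf-dist-> : ∀ {i j} → j Fin.< i → dist (leaf i) (leaf j) ≈ leg i + leg j + (α i - α j)
  leaf-dist-> j<i = trans (leaf-dist (Finₚ.<⇒≢ j<i ∘ ≡.sym))
    (+-congˡ (∣x∣≈x (≤⇒0≤- (α-increasing (ℕₚ.<⇒≤ j<i)))))

  leaf-dist-pos : ∀ {i j} → i ≢ j → 0# < dist (leaf i) (leaf j)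
  leaf-dist-pos {i} {j} i≢j = <-respʳ-≈ (sym (leaf-dist i≢j))
    (by-< (leg-pos i <+< leg-pos j <+≤ 0≤∣x∣ _)
      (solve 1 (λ s → s :- (con (+ 0) :+ con (+ 0) :+ con (+ 0)) := s :- con (+ 0)) refl _))

  ρ<-≢ : ∀ {x y z} → ρ x y < ρ x z → x ≢ z
  ρ<-≢ {x} {y} lt ≡.refl = D.ρ≮ρ-diag ρ dis x y x lt

  module _ {x y z} (lt : ρ x y < ρ x z) where

    -- Compatibility rules out that `z` comes before `y`. To the right of `x` the distance from its
    -- leaf is `α + β` plus a constant that depends only on `x`.
    mono-above : x Fin.< y → x Fin.< z → Tri (y Fin.< z) (y ≡ z) (z Fin.< y) →
                 dist (leaf x) (leaf y) < dist (leaf x) (leaf z)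
    mono-above x<y x<z (tri> _ _ z<y)    = ⊥-elim (<⇒≱ lt (proj₁ (compatible x<z z<y)))
    mono-above x<y x<z (tri≈ _ ≡.refl _) = ⊥-elim (irrefl refl lt)
    mono-above x<y x<z (tri< y<z _ _)    = <-respˡ-≈ (sym (leaf-dist-< x<y))
        (<-respʳ-≈ (sym (leaf-dist-< x<z))
      (by-< (strictly-increasing ℝ (λ i → α i + β i) α+β-step y<z)
        (solve 7 (λ lx ax ay by az bz c → (az :+ bz) :- (ay :+ by) :=
          (lx :+ (bz :+ c) :+ (az :- ax)) :- (lx :+ (by :+ c) :+ (ay :- ax)))
          refl (leg x) (α x) (α y) (β y) (α z) (β z) (proj₁ shift))))

    mono-below : y Fin.< x → z Fin.< x → Tri (y Fin.< z) (y ≡ z) (z Fin.< y) →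
                 dist (leaf x) (leaf y) < dist (leaf x) (leaf z)
    mono-below y<x z<x (tri< y<z _ _)    = ⊥-elim (<⇒≱ lt
      (≤-trans (inj₂ (ρ-sym x z)) (≤-trans (proj₂ (compatible y<z z<x)) (inj₂ (ρ-sym y x)))))
    mono-below y<x z<x (tri≈ _ ≡.refl _) = ⊥-elim (irrefl refl lt)
    mono-below y<x z<x (tri> _ _ z<y)    = <-respˡ-≈ (sym (leaf-dist-> y<x))
        (<-respʳ-≈ (sym (leaf-dist-> z<x))
      (by-< (strictly-increasing ℝ (λ i → α i - β i) α-β-step z<y)
        (solve 7 (λ lx ax ay by az bz c → (ay :- by) :- (az :- bz) :=
          (lx :+ (bz :+ c) :+ (ax :- az)) :- (lx :+ (by :+ c) :+ (ax :- ay)))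
          refl (leg x) (α x) (α y) (β y) (α z) (β z) (proj₁ shift))))

    -- The leg of `x` and the shift cancel: the difference of the two distances is row (y , z) with
    -- its centre moved to `x`.
    mono-across : y Fin.< x → x Fin.< z → dist (leaf x) (leaf y) < dist (leaf x) (leaf z)
    mono-across y<x x<z = <-respˡ-≈ (sym (leaf-dist-> y<x)) (<-respʳ-≈ (sym (leaf-dist-< x<z))
      (by-< (straddle-up y<x x<z (<-respˡ-≈ (ρ-sym x y) lt))
        (solve 7 (λ lx ax ay by az bz c → (ay :+ az :- con (+ 2) :* ax :- by :+ bz) :- con (+ 0) :=
          (lx :+ (bz :+ c) :+ (az :- ax)) :- (lx :+ (by :+ c) :+ (ax :- ay)))
          refl (leg x) (α x) (α y) (β y) (α z) (β z) (proj₁ shift))))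

    mono-back : x Fin.< y → z Fin.< x → dist (leaf x) (leaf y) < dist (leaf x) (leaf z)
    mono-back x<y z<x = <-respˡ-≈ (sym (leaf-dist-< x<y)) (<-respʳ-≈ (sym (leaf-dist-> z<x))
      (by-< (straddle-down z<x x<y (<-respʳ-≈ (ρ-sym x z) lt))
        (solve 7 (λ lx ax ay by az bz c → (:- az :- ay :+ con (+ 2) :* ax :+ bz :- by) :-
          con (+ 0) :=
          (lx :+ (bz :+ c) :+ (ax :- az)) :- (lx :+ (by :+ c) :+ (ay :- ax)))
          refl (leg x) (α x) (α y) (β y) (α z) (β z) (proj₁ shift))))

    leaves-mono : Tri (x Fin.< y) (x ≡ y) (y Fin.< x) → Tri (x Fin.< z) (x ≡ z) (z Fin.< x) →
                  dist (leaf x) (leaf y) < dist (leaf x) (leaf z)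
    leaves-mono _                 (tri≈ _ x≡z _) = ⊥-elim (ρ<-≢ lt x≡z)
    leaves-mono (tri≈ _ ≡.refl _) _              =
        <-respˡ-≈ (sym (dist-refl (leaf x))) (leaf-dist-pos (ρ<-≢ lt))
    leaves-mono (tri< x<y _ _)    (tri< x<z _ _) = mono-above x<y x<z (Finₚ.<-cmp y z)
    leaves-mono (tri> _ _ y<x)    (tri> _ _ z<x) = mono-below y<x z<x (Finₚ.<-cmp y z)
    leaves-mono (tri> _ _ y<x)    (tri< x<z _ _) = mono-across y<x x<z
    leaves-mono (tri< x<y _ _)    (tri> _ _ z<x) = mono-back x<y z<x

  drawing : D.AdmitsCaterpillarDrawing ρ
  drawing = caterpillar , leaf , leaf-injective ,
    λ x y z lt → leaves-mono lt (Finₚ.<-cmp x y) (Finₚ.<-cmp x z)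

open import Data.Nat.Base using (_+_)

lemma12 : (ℝ : RealNumbers) →
    let open RealNumbers ℝ using (Carrier)
        open Definitions ℝ
    in
    (m : ℕ) (ρ : Fin (2 + m) → Fin (2 + m) → Carrier) →
    (ρ-strictRobinson : IsStrictRobinson ρ) → Compatible _<ᶠ_ ρ →
    let Y-S = Y ρ (IsStrictRobinson.isDissimilarity ρ-strictRobinson)
    in
    AdmitsCaterpillarDrawing ρ ⇔
    (¬ ∃ λ (y : Vector Carrier (#N {suc m})) →
         NonNegative (Y-S *ⱽ y) × NonNegative y × ¬ IsZero y)
lemma12 ℝ m ρ robinson compatible = mk⇔ to from
  where
  open Definitions ℝ
  open IsStrictRobinson robinson renaming (isDissimilarity to dis)
  open System ℝ ρ dis using (feasible⇒infeasible; infeasible⇒feasible)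

  Infeasible : Set
  Infeasible = ¬ ∃ λ y → NonNegative (Y ρ dis *ⱽ y) × NonNegative y × ¬ IsZero y

  to : AdmitsCaterpillarDrawing ρ → Infeasible
  to (C , I , valid) = feasible⇒infeasible x B-pos N-pos
    where open Drawings.FromDrawing ℝ ρ dis compatible isStrict C I valid

  from : Infeasible → AdmitsCaterpillarDrawing ρ
  from infeasible with infeasible⇒feasible infeasible
  ... | x , B-pos , N-pos = ToDrawing.drawing ℝ ρ dis compatible x B-pos N-pos
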